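{- Let $\mathcal{G}=(V,\mathcal{E})$ be a (finite, simple) graph. Then $\mathcal{G}$ is join-irreducible if and only if $\check{\mathcal{G}}$ is isomorphic to one of the following graphs: (i) a disjoint union of $n$ copies of $K_3$, for some $n\ge 2$; (ii) $C_5$; (iii) $K_2+\overline{K}_m$, for some $m\geq 2$; (iv) $K_n$, for some $n\ge2$; (v) $\overline{K}_n+\overline{K}_m$, for some $n,m$ with $1\le n<m$; (vi) a graph join $\overline{K}_n+\cdots+\overline{K}_n$ of $r$ copies of $\overline{K}_n$, for some $r,n\ge2$.
   Context: A graph is a pair $\mathcal{G}=(V,\mathcal{E})$ with $V$ a finite nonempty set and $\mathcal{E}\subseteq[V]^2$ (two-element subsets of $V$). $\check{\mathcal{G}}$ denotes the graph obtained from $\mathcal{G}$ by removing its isolated vertices (those in no edge). $K_n$ is the complete graph on $n$ vertices, $\overline{K}_n$ its complement (the edgeless graph on $n$ vertices), $C_n$ the cycle on $n$ vertices. The graph join $\mathcal{G}_1+\mathcal{G}_2$ is the disjoint union of $\mathcal{G}_1$ and $\mathcal{G}_2$ together with all edges $\{i_1,i_2\}$, $i_1\in V_1$, $i_2\in V_2$; iterated joins are defined accordingly. Join-irreducible graph: a Boolean function is a map $f:\{0,1\}^n\to\{0,1\}$, $n\ge1$; $\Omega$ is the set of all of them. For $g$ of arity $m$ and $f$ of arity $n$, $g\le f$ ($g$ is a simple minor of $f$) if there is $\sigma:\{1,\dots,n\}\to\{1,\dots,m\}$ with $g(x_1,\dots,x_m)=f(x_{\sigma(1)},\dots,x_{\sigma(n)})$;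 $g<f$ means $g\le f$ and not $f\le g$. $f$ is irreducible if there is $f'\in\Omega$ with $f'<f$ such that every $g\in\Omega$ with $g<f$ satisfies $g\le f'$ (equivalently, the class of $f$ has a unique lower cover in the poset of equivalence classes of Boolean functions under simple minors). To a graph $\mathcal{G}=(V,\mathcal{E})$ (with $V$ identified with $\{1,\dots,n\}$) associate the $n$-ary Boolean function $f_{\mathcal{G}}$ given by evaluating over $GF(2)$ the polynomial $\sum_{\{i,j\}\in\mathcal{E}}x_ix_j$. $\mathcal{G}$ is join-irreducible if $f_{\mathcal{G}}$ is irreducible. -}

module Defs where

open import Data.Bool using (Bool; true; false; not; _∧_; _∨_; _xor_)
open import Data.Bool.Properties using (∨-comm)
open import Data.Fin using (Fin; toℕ; _≟_)
open import Data.Fin.Properties using (toℕ<n)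
open import Data.List using (List; allFin; cartesianProduct; filterᵇ; foldr; map)
open import Data.Nat using (ℕ; zero; suc; _≤_; _<_; _<ᵇ_; _≡ᵇ_; NonZero; _%_; _≤?_; s≤s)
open import Data.Nat.DivMod using (m<n⇒m%n≡m; n%n≡0)
open import Data.Nat.Properties using (≡ᵇ⇒≡; m≤n⇒m<n∨m≡n; 1+n≢n)
open import Data.Product using (Σ-syntax; ∃-syntax; _×_; _,_)
open import Data.Refinement using (value; Refinement-syntax)
open import Data.Sum using (_⊎_; inj₁; inj₂)
open import Data.Vec using (Vec; lookup; tabulate)
open import Function using (_↔_; Inverse)
open import Relation.Binary.PropositionalEquality
  using (_≡_; refl; sym; trans; cong; cong₂; _≢_; ≢-sym)
open import Relation.Nullary using (¬_; yes; no; does; contradiction)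
open import Relation.Nullary.Decidable using (True; toWitness; dec-true; dec-false)

record BooleanFunction : Set where
  constructor booleanFunction
  field
    arity         : ℕ
    .{{nonZero}}  : NonZero arity
    apply         : Vec Bool arity → Bool

open BooleanFunction public using (arity; apply)

infix 4 _≼_ _≺_

-- g ≼ f: g is a simple minor of f.
_≼_ : BooleanFunction → BooleanFunction → Set
g ≼ f = Σ[ σ ∈ (Fin (arity f) → Fin (arity g)) ]
          (∀ x → apply g x ≡ apply f (tabulate (λ i → lookup x (σ i))))

_≺_ : BooleanFunction → BooleanFunction → Set
g ≺ f = g ≼ f × ¬ (f ≼ g)

Irreducible : BooleanFunction → Set
Irreducible f = ∃[ f′ ] (f′ ≺ f × (∀ g → g ≺ f → g ≼ f′))

record Graph (V : Set) : Set where
  field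
    adj        : V → V → Bool
    adj-sym    : ∀ u v → adj u v ≡ adj v u
    adj-irrefl : ∀ v → adj v v ≡ false

open Graph public

infix 4 _≅_

_≅_ : {V W : Set} → Graph V → Graph W → Set
_≅_ {V} {W} G H = Σ[ φ ∈ V ↔ W ]
  (∀ u v → adj H (Inverse.to φ u) (Inverse.to φ v) ≡ adj G u v)

NonIsolated : {V : Set} → Graph V → V → Set
NonIsolated G v = ∃[ u ] adj G v u ≡ true

-- Refinement makes the membership proofs irrelevant, so that a vertex with
-- several neighbours is still counted once.
removeIsolated : {V : Set} (G : Graph V) → Graph [ v ∈ V ∣ NonIsolated G v ]
removeIsolated G .adj u v = adj G (value u) (value v)
removeIsolated G .adj-sym u v = adj-sym G (value u) (value v)
removeIsolated G .adj-irrefl v = adj-irrefl G (value v)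

edgeless : (n : ℕ) → Graph (Fin n)
edgeless n .adj _ _ = false
edgeless n .adj-sym _ _ = refl
edgeless n .adj-irrefl _ = refl

complete : (n : ℕ) → Graph (Fin n)
complete n .adj i j = not (does (i ≟ j))
complete n .adj-sym i j with i ≟ j
... | yes i≡j = cong not (sym (dec-true (j ≟ i) (sym i≡j)))
... | no  i≢j = cong not (sym (dec-false (j ≟ i) (≢-sym i≢j)))
complete n .adj-irrefl i = cong not (dec-true (i ≟ i) refl)

private
  suc%≢ : ∀ n .{{_ : NonZero n}} → 3 ≤ n → ∀ k → k < n → suc k % n ≢ k
  suc%≢ n 3≤n k k<n eq with m≤n⇒m<n∨m≡n k<n
  ... | inj₁ 1+k<n = 1+n≢n (trans (sym (m<n⇒m%n≡m 1+k<n)) eq)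
  ... | inj₂ refl with trans (sym (n%n≡0 (suc k))) eq
  ...   | refl = contradiction 3≤n λ { (s≤s ()) }

  ≢⇒≡ᵇ-false : ∀ m n → m ≢ n → (m ≡ᵇ n) ≡ false
  ≢⇒≡ᵇ-false m n m≢n with m ≡ᵇ n | ≡ᵇ⇒≡ m n
  ... | false | _ = refl
  ... | true  | f = contradiction (f _) m≢n

cycle : (n : ℕ) .{{_ : NonZero n}} {3≤n : True (3 ≤? n)} → Graph (Fin n)
cycle n .adj i j = (suc (toℕ i) % n ≡ᵇ toℕ j) ∨ (suc (toℕ j) % n ≡ᵇ toℕ i)
cycle n .adj-sym i j = ∨-comm (suc (toℕ i) % n ≡ᵇ toℕ j) _
cycle n {3≤n} .adj-irrefl i = cong₂ _∨_ loopless loopless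
  where
  loopless : (suc (toℕ i) % n ≡ᵇ toℕ i) ≡ false
  loopless = ≢⇒≡ᵇ-false _ _ (suc%≢ n (toWitness 3≤n) (toℕ i) (toℕ<n i))

-- Disjoint union _⊕_ and graph join _⋈_.
infixr 5 _⊕_ _⋈_

_⊕_ : {V W : Set} → Graph V → Graph W → Graph (V ⊎ W)
(G ⊕ H) .adj (inj₁ u) (inj₁ v) = adj G u v
(G ⊕ H) .adj (inj₁ _) (inj₂ _) = false
(G ⊕ H) .adj (inj₂ _) (inj₁ _) = false
(G ⊕ H) .adj (inj₂ u) (inj₂ v) = adj H u v
(G ⊕ H) .adj-sym (inj₁ u) (inj₁ v) = adj-sym G u v
(G ⊕ H) .adj-sym (inj₁ _) (inj₂ _) = refl
(G ⊕ H) .adj-sym (inj₂ _) (inj₁ _) = refl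
(G ⊕ H) .adj-sym (inj₂ u) (inj₂ v) = adj-sym H u v
(G ⊕ H) .adj-irrefl (inj₁ v) = adj-irrefl G v
(G ⊕ H) .adj-irrefl (inj₂ v) = adj-irrefl H v

_⋈_ : {V W : Set} → Graph V → Graph W → Graph (V ⊎ W)
(G ⋈ H) .adj (inj₁ u) (inj₁ v) = adj G u v
(G ⋈ H) .adj (inj₁ _) (inj₂ _) = true
(G ⋈ H) .adj (inj₂ _) (inj₁ _) = true
(G ⋈ H) .adj (inj₂ u) (inj₂ v) = adj H u v
(G ⋈ H) .adj-sym (inj₁ u) (inj₁ v) = adj-sym G u v
(G ⋈ H) .adj-sym (inj₁ _) (inj₂ _) = refl
(G ⋈ H) .adj-sym (inj₂ _) (inj₁ _) = refl
(G ⋈ H) .adj-sym (inj₂ u) (inj₂ v) = adj-sym H u v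
(G ⋈ H) .adj-irrefl (inj₁ v) = adj-irrefl G v
(G ⋈ H) .adj-irrefl (inj₂ v) = adj-irrefl H v

-- The iterated operations start from the graph with no vertices, which is a
-- unit for both of them up to isomorphism.
Copies : ℕ → Set → Set
Copies zero    V = Fin 0
Copies (suc r) V = V ⊎ Copies r V

unionOfCopies : {V : Set} (r : ℕ) → Graph V → Graph (Copies r V)
unionOfCopies zero    G = edgeless 0
unionOfCopies (suc r) G = G ⊕ unionOfCopies r G

joinOfCopies : {V : Set} (r : ℕ) → Graph V → Graph (Copies r V)
joinOfCopies zero    G = edgeless 0
joinOfCopies (suc r) G = G ⋈ joinOfCopies r G

module _ {V : Set} {n : ℕ} (numbering : Fin n ↔ V) (G : Graph V) where

  open Inverse numbering using (to)

  -- Each edge {i , j} is listed once, with i < j.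
  edges : List (Fin n × Fin n)
  edges = filterᵇ (λ (i , j) → (toℕ i <ᵇ toℕ j) ∧ adj G (to i) (to j))
                  (cartesianProduct (allFin n) (allFin n))

  -- Over GF(2), addition is _xor_ and multiplication is _∧_.
  edgePolynomial : Vec Bool n → Bool
  edgePolynomial x = foldr _xor_ false (map (λ (i , j) → lookup x i ∧ lookup x j) edges)

  JoinIrreducible : .{{NonZero n}} → Set
  JoinIrreducible = Irreducible (booleanFunction n edgePolynomial)

{-# OPTIONS --safe #-}
module Submission where

-- A minor of f strictly below f identifies two essential variables, that is, two non-isolated vertices, so f is
-- irreducible exactly when some pair (i , j) dominates every other pair (k , l): identifying k and l gives a minor of
-- what identifying i and j gives.
--
-- Identifying k and l makes a further variable inessential in only two cases: when some vertex has neighbourhood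
-- {k , l} (an apex), and when k and l are non-adjacent twins. In all other cases domination is an isomorphism between
-- the two identified forms, so k and l are adjacent exactly when i and j are, and for an edge the numbers of vertices
-- distinguished by the two pairs agree. Hence, if i and j are not adjacent, every edge has an apex and the graph is a
-- union of triangles. If they are adjacent, every non-edge has an apex or consists of twins: a failure of transitivity
-- of non-adjacency unfolds into a pentagon, and otherwise the graph is complete multipartite. There an edge with an
-- apex leaves K_n and K_2 + co-K_m, and without one the sizes of the parts of the ends of an edge have a constant sum.
--
-- Conversely, a pair with an apex v is dominated by every pair containing v, a pair of non-adjacent twins by every pair
-- containing one of them, and automorphisms move the remaining pairs to each other.

open import Defs
open import Data.Bool using (Bool; true; false; not; _∧_; _∨_; _xor_; if_then_else_)
import Data.Bool.Properties as Bool
open import Data.Bool.Solver using (module xor-∧-Solver)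
open import Data.Empty using (⊥; ⊥-elim)
open import Data.Fin using (Fin; zero; suc; toℕ; _≟_; punchOut)
open import Data.Fin.Permutation.Components using (transpose; transpose-inverse)
import Data.Fin.Properties as Fin
open import Data.List using (List; []; _∷_; _++_; allFin; tabulate; cartesianProduct; filterᵇ; foldr; map)
import Data.List.Properties as List
open import Data.Nat using (ℕ; zero; suc; NonZero; _≤_; _<_; _<ᵇ_; _+_; z≤n; s≤s)
import Data.Nat.Properties as ℕ
open import Algebra.Properties.CommutativeMonoid.Sum ℕ.+-0-commutativeMonoid
  using (sum; sum-permute; ∑-distrib-+; sum-cong-≗)
open import Data.Product using (Σ-syntax; ∃-syntax; _×_; _,_; proj₁; proj₂)
open import Data.Irrelevant using ([_])
open import Data.Refinement using (value; Refinement-syntax; _,_)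
open import Data.Refinement.Properties using (value-injective)
open import Data.Sum using (_⊎_; inj₁; inj₂; [_,_]′)
import Data.Vec as Vec
import Data.Vec.Properties as Vec
open import Data.Vec.Functional using () renaming (_∷_ to _◂_)
open import Function using (_↔_; _⇔_; _∘_; id; Inverse; mk↔ₛ′; mk⇔)
open import Function.Construct.Composition using (_↔-∘_)
open import Function.Construct.Identity using (↔-id)
open import Function.Construct.Symmetry using (↔-sym)
open import Relation.Binary.Definitions using (Tri; tri<; tri≈; tri>)
open import Relation.Binary.PropositionalEquality
open import Relation.Nullary using (¬_; recompute; Dec; yes; no; does; contradiction; ¬?; _×-dec_; _⊎-dec_; _→-dec_)
open import Relation.Nullary.Decidable using (dec-true; dec-false; from-yes)

-- The edge polynomial as a quadratic form

xorSum : {A : Set} → (A → Bool) → List A → Bool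
xorSum g xs = foldr _xor_ false (map g xs)

module _ {A : Set} where

  xorSum-cong : {g h : A → Bool} → (∀ a → g a ≡ h a) → ∀ xs → xorSum g xs ≡ xorSum h xs
  xorSum-cong g≗h xs = cong (foldr _xor_ false) (List.map-cong g≗h xs)

  xorSum-false : {g : A → Bool} → (∀ a → g a ≡ false) → ∀ xs → xorSum g xs ≡ false
  xorSum-false eq []       = refl
  xorSum-false eq (x ∷ xs) = cong₂ _xor_ (eq x) (xorSum-false eq xs)

  xorSum-xor : (g h : A → Bool) → ∀ xs → xorSum (λ a → g a xor h a) xs ≡ xorSum g xs xor xorSum h xs
  xorSum-xor g h []       = refl
  xorSum-xor g h (x ∷ xs) = trans (cong ((g x xor h x) xor_) (xorSum-xor g h xs))
    (solve 4 (λ a b c d → (a :+ b) :+ (c :+ d) := (a :+ c) :+ (b :+ d)) refl (g x) (h x) (xorSum g xs) (xorSum h xs))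
    where open xor-∧-Solver

  xorSum-∧ : (b : Bool) (g : A → Bool) → ∀ xs → xorSum (λ a → b ∧ g a) xs ≡ b ∧ xorSum g xs
  xorSum-∧ true  g xs = refl
  xorSum-∧ false g xs = xorSum-false (λ _ → refl) xs

  xorSum-++ : (g : A → Bool) → ∀ xs ys → xorSum g (xs ++ ys) ≡ xorSum g xs xor xorSum g ys
  xorSum-++ g []       ys = refl
  xorSum-++ g (x ∷ xs) ys = trans (cong (g x xor_) (xorSum-++ g xs ys)) (sym (Bool.xor-assoc (g x) _ _))

  xorSum-filter : (P g : A → Bool) → ∀ xs → xorSum g (filterᵇ P xs) ≡ xorSum (λ a → P a ∧ g a) xs
  xorSum-filter P g []       = refl
  xorSum-filter P g (x ∷ xs) with P x
  ... | true  = cong (g x xor_) (xorSum-filter P g xs)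
  ... | false = xorSum-filter P g xs

xorSum-product : {A B : Set} (g : A × B → Bool) → ∀ xs ys →
  xorSum g (cartesianProduct xs ys) ≡ xorSum (λ x → xorSum (λ y → g (x , y)) ys) xs
xorSum-product g []       ys = refl
xorSum-product g (x ∷ xs) ys = trans (xorSum-++ g (map (x ,_) ys) _)
  (cong₂ _xor_ (cong (foldr _xor_ false) (sym (List.map-∘ ys))) (xorSum-product g xs ys))

δ : ∀ {n} → Fin n → Fin n → Bool
δ u v = does (u ≟ v)

δ-refl : ∀ {n} (u : Fin n) → δ u u ≡ true
δ-refl u = dec-true (u ≟ u) refl

δ-≡ : ∀ {n} {u v : Fin n} → u ≡ v → δ u v ≡ true
δ-≡ {u = u} refl = δ-refl u

δ-≢ : ∀ {n} {u v : Fin n} → u ≢ v → δ u v ≡ false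
δ-≢ {u = u} {v} = dec-false (u ≟ v)

δ-true : ∀ {n} {u v : Fin n} → δ u v ≡ true → u ≡ v
δ-true {u = u} {v} eq with u ≟ v
... | yes p = p
... | no  _ with () ← eq

Point : ℕ → Set
Point n = Fin n → Bool

origin : ∀ {n} → Point n
origin _ = false

xorSum-allFin : ∀ {n} (g : Fin n → Bool) → xorSum g (allFin n) ≡ foldr _xor_ false (tabulate g)
xorSum-allFin g = cong (foldr _xor_ false) (List.map-tabulate id g)

xorSum-δ : ∀ {n} (v : Fin n) (h : Fin n → Bool) → xorSum (λ i → δ v i ∧ h i) (allFin n) ≡ h v
xorSum-δ v h = trans (xorSum-allFin (λ i → δ v i ∧ h i)) (go v h)
  where
  go : ∀ {n} (v : Fin n) (h : Fin n → Bool) → foldr _xor_ false (tabulate (λ i → δ v i ∧ h i)) ≡ h v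
  go {suc n} zero    h = trans (cong (h zero xor_) (trans (sym (xorSum-allFin {n} origin)) (xorSum-false (λ _ → refl) (allFin n))))
    (Bool.xor-identityʳ (h zero))
  go         (suc v) h = go v (h ∘ suc)

flip : ∀ {n} → Point n → Fin n → Point n
flip x v w = x w xor δ v w

Adjacency : ℕ → Set
Adjacency n = Fin n → Fin n → Bool

-- The quadratic form over GF(2) with polarisation A and no linear terms, characterised by its first and second
-- differences.
record Quadratic {n} (A : Adjacency n) (q : Point n → Bool) : Set where
  field
    q-cong   : ∀ {x y} → x ≗ y → q x ≡ q y
    q-origin : q origin ≡ false

  D : Fin n → Point n → Bool
  D v x = q (flip x v) xor q x

  field
    D-origin : ∀ v → D v origin ≡ false
    D-flip   : ∀ v x u → D v (flip x u) ≡ D v x xor A v u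

module _ {V : Set} {n : ℕ} (numbering : Fin n ↔ V) (G : Graph V) where

  open Inverse numbering using (to)

  private
    A : Adjacency n
    A u v = adj G (to u) (to v)

    c : Fin n × Fin n → Bool
    c (i , j) = (toℕ i <ᵇ toℕ j) ∧ A i j

  polynomial : Point n → Bool
  polynomial x = xorSum (λ (i , j) → x i ∧ x j) (edges numbering G)

  apply-polynomial : ∀ x → edgePolynomial numbering G (Vec.tabulate x) ≡ polynomial x
  apply-polynomial x = xorSum-cong
    (λ (i , j) → cong₂ _∧_ (Vec.lookup∘tabulate x i) (Vec.lookup∘tabulate x j)) (edges numbering G)

  private
    overEdges : ∀ g → xorSum g (edges numbering G) ≡ xorSum (λ i → xorSum (λ j → c (i , j) ∧ g (i , j)) (allFin n)) (allFin n)
    overEdges g = trans (xorSum-filter c g (cartesianProduct (allFin n) (allFin n)))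
      (xorSum-product (λ e → c e ∧ g e) (allFin n) (allFin n))

    c-loop : ∀ v → c (v , v) ≡ false
    c-loop v = trans (cong ((toℕ v <ᵇ toℕ v) ∧_) (adj-irrefl G (to v))) (Bool.∧-zeroʳ _)

    <ᵇ-true : ∀ {i j} → i < j → (i <ᵇ j) ≡ true
    <ᵇ-true i<j = Bool.T-≡ .Function.Equivalence.to (ℕ.<⇒<ᵇ i<j)

    <ᵇ-false : ∀ {i j} → ¬ (i < j) → (i <ᵇ j) ≡ false
    <ᵇ-false {i} {j} i≮j with i <ᵇ j in eq
    ... | false = refl
    ... | true  = contradiction (ℕ.<ᵇ⇒< i j (Bool.T-≡ .Function.Equivalence.from eq)) i≮j

    -- `c` keeps a pair only in the orientation with the smaller index first, so for distinct `v`
    -- and `u` one summand is zero and the other is the adjacency. On the diagonal both sides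
    -- vanish.
    c-sym : ∀ v u → c (v , u) xor c (u , v) ≡ A v u
    c-sym v u with Fin.<-cmp v u
    ... | tri< v<u _ u≮v rewrite <ᵇ-true v<u | <ᵇ-false u≮v = Bool.xor-identityʳ _
    ... | tri> v≮u _ u<v rewrite <ᵇ-true u<v | <ᵇ-false v≮u = adj-sym G _ _
    ... | tri≈ _ refl _  rewrite c-loop v = sym (adj-irrefl G (to v))

    select : ∀ v u → xorSum (λ i → xorSum (λ j → c (i , j) ∧ (δ v i ∧ δ u j)) (allFin n)) (allFin n) ≡ c (v , u)
    select v u = trans (xorSum-cong (λ i →
        trans (xorSum-cong (λ j → rearrange (c (i , j)) (δ v i) (δ u j)) (allFin n))
        (trans (xorSum-∧ (δ v i) _ (allFin n)) (cong (δ v i ∧_) (xorSum-δ u (λ j → c (i , j)))))) (allFin n))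
      (xorSum-δ v (λ i → c (i , u)))
      where
      open xor-∧-Solver
      rearrange : ∀ x y z → x ∧ (y ∧ z) ≡ y ∧ (z ∧ x)
      rearrange = solve 3 (λ x y z → x :* (y :* z) := y :* (z :* x)) refl

    q : Point n → Bool
    q = polynomial

    -- The second difference, in the directions `v` and `u`, of the monomial with indices `i` and
    -- `j`; its sum over the edges is the polarisation.
    cross : Fin n → Fin n → Fin n × Fin n → Bool
    cross v u (i , j) = (δ v i ∧ δ u j) xor (δ u i ∧ δ v j)

    cross-sum : ∀ v u → xorSum (cross v u) (edges numbering G) ≡ A v u
    cross-sum v u = begin
      xorSum (cross v u) (edges numbering G)
        ≡⟨ xorSum-xor (λ (i , j) → δ v i ∧ δ u j) (λ (i , j) → δ u i ∧ δ v j) (edges numbering G) ⟩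
      xorSum (λ (i , j) → δ v i ∧ δ u j) (edges numbering G) xor xorSum (λ (i , j) → δ u i ∧ δ v j) (edges numbering G)
        ≡⟨ cong₂ _xor_ (trans (overEdges _) (select v u)) (trans (overEdges _) (select u v)) ⟩
      c (v , u) xor c (u , v)
        ≡⟨ c-sym v u ⟩
      A v u ∎
      where open ≡-Reasoning

    D-termwise : ∀ v x → polynomial (flip x v) xor polynomial x
      ≡ xorSum (λ (i , j) → (flip x v i ∧ flip x v j) xor (x i ∧ x j)) (edges numbering G)
    D-termwise v x = sym (xorSum-xor (λ (i , j) → flip x v i ∧ flip x v j) (λ (i , j) → x i ∧ x j) (edges numbering G))

  polynomial-quadratic : Quadratic A polynomial
  polynomial-quadratic = record
    { q-cong   = λ x≗y → xorSum-cong (λ (i , j) → cong₂ _∧_ (x≗y i) (x≗y j)) (edges numbering G)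
    ; q-origin = xorSum-false (λ _ → refl) (edges numbering G)
    ; D-origin = λ v → cong₂ _xor_
        (trans (overEdges _) (xorSum-false (λ i → xorSum-false (λ j → single v i j) (allFin n)) (allFin n)))
        (xorSum-false (λ _ → refl) (edges numbering G))
    ; D-flip   = λ v x u → begin
        polynomial (flip (flip x u) v) xor polynomial (flip x u)
          ≡⟨ D-termwise v (flip x u) ⟩
        xorSum (λ (i , j) → (flip (flip x u) v i ∧ flip (flip x u) v j) xor (flip x u i ∧ flip x u j)) (edges numbering G)
          ≡⟨ xorSum-cong (λ (i , j) → second (x i) (x j) (δ u i) (δ u j) (δ v i) (δ v j)) (edges numbering G) ⟩
        xorSum (λ (i , j) → ((flip x v i ∧ flip x v j) xor (x i ∧ x j)) xor cross v u (i , j)) (edges numbering G)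
          ≡⟨ xorSum-xor (λ (i , j) → (flip x v i ∧ flip x v j) xor (x i ∧ x j)) (cross v u) (edges numbering G) ⟩
        xorSum (λ (i , j) → (flip x v i ∧ flip x v j) xor (x i ∧ x j)) (edges numbering G)
          xor xorSum (cross v u) (edges numbering G)
          ≡⟨ cong₂ _xor_ (sym (D-termwise v x)) (cross-sum v u) ⟩
        (polynomial (flip x v) xor polynomial x) xor A v u ∎
    }
    where
    open ≡-Reasoning
    -- At a unit point a monomial is nonzero only if both its indices equal `v`, and `c` excludes
    -- loops.
    single : ∀ v i j → c (i , j) ∧ (δ v i ∧ δ v j) ≡ false
    single v i j with v ≟ i | v ≟ j
    ... | yes refl | yes refl = trans (Bool.∧-identityʳ _) (c-loop v)
    ... | yes _    | no _     = Bool.∧-zeroʳ _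
    ... | no _     | _        = Bool.∧-zeroʳ _
    open xor-∧-Solver
    second : ∀ a b p q r s → (((a xor p) xor r) ∧ ((b xor q) xor s)) xor ((a xor p) ∧ (b xor q))
      ≡ (((a xor r) ∧ (b xor s)) xor (a ∧ b)) xor ((r ∧ q) xor (p ∧ s))
    second = solve 6 (λ a b p q r s → (((a :+ p) :+ r) :* ((b :+ q) :+ s)) :+ ((a :+ p) :* (b :+ q))
      := (((a :+ r) :* (b :+ s)) :+ (a :* b)) :+ ((r :* q) :+ (p :* s))) refl

-- Every point arises from the origin by flipping finitely many coordinates. As points are
-- functions, `resp` stands in for function extensionality.
point-induction : ∀ {n} (P : Point n → Set) → (∀ {x y} → x ≗ y → P x → P y) →
  P origin → (∀ x v → P x → P (flip x v)) → ∀ x → P x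
point-induction {zero}  P resp base step x = resp (λ ()) base
point-induction {suc n} P resp base step x = go (x zero) refl
  where
  tail : P (false ◂ (x ∘ suc))
  tail = point-induction (λ y → P (false ◂ y)) (λ y≗z → resp λ { zero → refl ; (suc i) → y≗z i })
    (resp (λ { zero → refl ; (suc _) → refl }) base)
    (λ y v p → resp (λ { zero → refl ; (suc _) → refl }) (step _ (suc v) p)) (x ∘ suc)
  go : ∀ b → x zero ≡ b → P x
  go false eq = resp (λ { zero → sym eq ; (suc _) → refl }) tail
  go true  eq = resp (λ { zero → sym eq ; (suc i) → Bool.xor-identityʳ _ }) (step _ zero tail)

xor-cancelʳ : ∀ a b → (a xor b) xor b ≡ a
xor-cancelʳ a b = trans (Bool.xor-assoc a b b) (trans (cong (a xor_) (Bool.xor-same b)) (Bool.xor-identityʳ a))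

flip-off : ∀ {n m} (x : Point n) {v} (π : Fin m → Fin n) → (∀ t → π t ≢ v) → flip x v ∘ π ≗ x ∘ π
flip-off x π off t = trans (cong (x (π t) xor_) (δ-≢ (off t ∘ sym))) (Bool.xor-identityʳ _)

flip-cong : ∀ {n} {x y : Point n} → x ≗ y → ∀ v → flip x v ≗ flip y v
flip-cong x≗y v w = cong (_xor δ v w) (x≗y w)

module _ {n} {A : Adjacency n} {q} (Q : Quadratic A q) where

  open Quadratic Q

  D-cong : ∀ v {x y} → x ≗ y → D v x ≡ D v y
  D-cong v x≗y = cong₂ _xor_ (q-cong (flip-cong x≗y v)) (q-cong x≗y)

  q-flip : ∀ x v → q (flip x v) ≡ D v x xor q x
  q-flip x v = sym (xor-cancelʳ _ _)

module _ {a b} (G : Graph (Fin a)) (H : Graph (Fin b)) {q q′} (Q : Quadratic (adj G) q) (Q′ : Quadratic (adj H) q′)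
  (π : Fin b → Fin a) (π-injective : ∀ {s t} → π s ≡ π t → s ≡ t)
  (π-adj : ∀ s t → adj G (π s) (π t) ≡ adj H s t)
  (covers : ∀ v u → adj G v u ≡ true → ∃[ t ] π t ≡ v) where

  private
    module Q  = Quadratic Q
    module Q′ = Quadratic Q′

    flip-π : ∀ x t → flip x (π t) ∘ π ≗ flip (x ∘ π) t
    flip-π x t s with t ≟ s
    ... | yes refl = cong (x (π t) xor_) (δ-refl (π t))
    ... | no  t≢s  = cong (x (π s) xor_) (δ-≢ (t≢s ∘ π-injective))

    image? : ∀ v → (∃[ t ] π t ≡ v) ⊎ ((∀ t → π t ≢ v) × (∀ u → adj G v u ≡ false))
    image? v with Fin.any? (λ t → π t ≟ v)
    ... | yes p = inj₁ p
    ... | no ¬p = inj₂ ((λ t eq → ¬p (t , eq)) , λ u → Bool.¬-not (¬p ∘ covers v u))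

    D-pullback : ∀ t x → Q′.D t (x ∘ π) ≡ Q.D (π t) x
    D-pullback t = point-induction _
      (λ x≗y p → trans (sym (D-cong Q′ t (x≗y ∘ π))) (trans p (D-cong Q (π t) x≗y)))
      (trans (Q′.D-origin t) (sym (Q.D-origin (π t)))) step
      where
      step : ∀ x v → Q′.D t (x ∘ π) ≡ Q.D (π t) x → Q′.D t (flip x v ∘ π) ≡ Q.D (π t) (flip x v)
      step x v p with image? v
      ... | inj₁ (s , refl) = trans (D-cong Q′ t (flip-π x s)) (trans (Q′.D-flip t (x ∘ π) s)
              (trans (cong₂ _xor_ p (sym (π-adj t s))) (sym (Q.D-flip (π t) x (π s)))))
      ... | inj₂ (off , isolated) = trans (D-cong Q′ t (flip-off x π off)) (trans p (sym
              (trans (Q.D-flip (π t) x v)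
              (trans (cong (Q.D (π t) x xor_) (trans (adj-sym G (π t) v) (isolated (π t)))) (Bool.xor-identityʳ _)))))

    D-isolated : ∀ v → (∀ u → adj G v u ≡ false) → ∀ x → Q.D v x ≡ false
    D-isolated v isolated = point-induction _ (λ x≗y → trans (sym (D-cong Q v x≗y))) (Q.D-origin v)
      (λ x u p → trans (Q.D-flip v x u) (cong₂ _xor_ p (isolated u)))

  -- Both sides vanish at the origin. Flipping a vertex in the image of `π` changes them by first
  -- differences, which agree by `D-pullback` since the second differences are the adjacencies; any
  -- other vertex is isolated, and flipping it changes neither side. This serves both to delete
  -- isolated vertices and to let automorphisms act on `q`.
  pullback : ∀ x → q x ≡ q′ (x ∘ π)
  pullback = point-induction _ (λ x≗y p → trans (sym (Q.q-cong x≗y)) (trans p (Q′.q-cong (x≗y ∘ π))))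
    (trans Q.q-origin (sym Q′.q-origin)) step
    where
    step : ∀ x v → q x ≡ q′ (x ∘ π) → q (flip x v) ≡ q′ (flip x v ∘ π)
    step x v p with image? v
    ... | inj₁ (t , refl) = trans (q-flip Q x (π t)) (trans (cong₂ _xor_ (sym (D-pullback t x)) p)
            (trans (sym (q-flip Q′ (x ∘ π) t)) (sym (Q′.q-cong (flip-π x t)))))
    ... | inj₂ (off , isolated) = trans (q-flip Q x v) (trans (cong (_xor q x) (D-isolated v isolated x))
            (trans p (sym (Q′.q-cong (flip-off x π off)))))

-- Irreducibility as domination of pairs of variables

-- Pigeonhole: if distinct `a` and `b` collide, one of them is not the chosen preimage of their
-- common image, hence not the chosen preimage of anything, and the chosen preimages inject
-- `Fin (suc n)` into `Fin n`.
surjective⇒injective : ∀ {n} (θ : Fin n → Fin n) → (∀ v → ∃[ t ] θ t ≡ v) → ∀ {a b} → θ a ≡ θ b → a ≡ b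
surjective⇒injective {suc n} θ surj {a} {b} θa≡θb with a ≟ b
... | yes a≡b = a≡b
... | no  a≢b = ⊥-elim (omit a refl λ a≡ → omit b (sym θa≡θb) λ b≡ → a≢b (trans a≡ (sym b≡)))
  where
  omit : ∀ c → θ c ≡ θ a → c ≢ proj₁ (surj (θ a)) → ⊥
  omit c θc≡ c≢ = ℕ.1+n≰n (Fin.injective⇒≤ {f = λ w → punchOut (avoid w)}
    (λ {u} {w} eq → trans (sym (proj₂ (surj u)))
      (trans (cong θ (Fin.punchOut-injective (avoid u) (avoid w) eq)) (proj₂ (surj w)))))
    where
    avoid : ∀ w → c ≢ proj₁ (surj w)
    avoid w refl = c≢ (cong (proj₁ ∘ surj) (trans (sym (proj₂ (surj w))) θc≡))

extension : ∀ {a b} {C : Set} (h : Fin a → Fin b) → (∀ {s t} → h s ≡ h t → s ≡ t) → C → (val : Fin a → C) →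
  Σ[ β ∈ (Fin b → C) ] (∀ t → β (h t) ≡ val t)
extension {b = b} {C} h injective default val = β , β-h
  where
  β : Fin b → C
  β s with Fin.any? (λ t → h t ≟ s)
  ... | yes (t , _) = val t
  ... | no _        = default
  β-h : ∀ t → β (h t) ≡ val t
  β-h t with Fin.any? (λ s → h s ≟ h t)
  ... | yes (s , eq) = cong val (injective eq)
  ... | no none      = contradiction (t , refl) none

merge : ∀ {n} → Fin n → Fin n → Fin n → Fin n
merge k l v = if δ v k then l else v

merge-≢ : ∀ {n} {k l v : Fin n} → v ≢ k → merge k l v ≡ v
merge-≢ v≢k rewrite δ-≢ v≢k = refl

merge-here : ∀ {n} (k l : Fin n) → merge k l k ≡ l
merge-here k l rewrite δ-refl k = refl

merge-there : ∀ {n} (k l : Fin n) → merge k l l ≡ l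
merge-there k l with l ≟ k
... | yes _ = refl
... | no  _ = refl

merge-absorb : ∀ {n} {C : Set} (τ : Fin n → C) {k l} → τ k ≡ τ l → τ ∘ merge k l ≗ τ
merge-absorb τ {k} {l} eq v with v ≟ k
... | yes refl = sym eq
... | no  _    = refl

-- Identifying k and l in q gives a minor of what identifying i and j gives.
Dominates : ∀ {n} → (Point n → Bool) → (i j k l : Fin n) → Set
Dominates {n} q i j k l = (τ : Fin n → Fin n) → τ k ≡ τ l →
  Σ[ σ ∈ (Fin n → Fin n) ] (σ i ≡ σ j × (∀ y → q (y ∘ τ) ≡ q (y ∘ σ)))

Greatest : ∀ {n} → (Point n → Bool) → Set
Greatest {n} q = ∃[ i ] ∃[ j ] (i ≢ j × (∀ k l → k ≢ l → Dominates {n} q i j k l))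

-- If `θ` missed `v`, flipping `v` could not change `q (y ∘ θ)`, so the first difference at `v`
-- would vanish. At the unit point of a neighbour `u` it equals `A v u`, which is true.
reproduce-surjective : ∀ {n} {A : Adjacency n} {q} → Quadratic A q → (∀ v → ∃[ u ] A v u ≡ true) →
  (θ : Fin n → Fin n) → (∀ y → q y ≡ q (y ∘ θ)) → ∀ v → ∃[ t ] θ t ≡ v
reproduce-surjective {A = A} {q} Q neighbour θ same v with Fin.any? (λ t → θ t ≟ v)
... | yes p = p
... | no ¬p with neighbour v
...   | u , Avu = contradiction (trans (sym Avu) (trans (sym D≡) D≡false)) λ ()
  where
  open Quadratic Q
  y = flip origin u
  D≡ : D v y ≡ A v u
  D≡ = trans (D-flip v origin u) (cong (_xor A v u) (D-origin v))
  D≡false : D v y ≡ false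
  D≡false = trans (cong (_xor q y) (trans (same (flip y v)) (trans (q-cong (flip-off y θ λ t eq → ¬p (t , eq))) (sym (same y)))))
    (Bool.xor-same (q y))

module Criterion {V : Set} {n : ℕ} .{{_ : NonZero n}} (numbering : Fin n ↔ V) (G : Graph V)
  {N} {A : Adjacency N} {q : Point N → Bool} (Q : Quadratic A q) (neighbour : ∀ v → ∃[ u ] A v u ≡ true)
  (e : Fin N → Fin n) (e-injective : ∀ {s t} → e s ≡ e t → s ≡ t)
  (f-q : ∀ x → polynomial numbering G x ≡ q (x ∘ e)) where

  open Quadratic Q using (q-cong)

  F : BooleanFunction
  F = booleanFunction n (edgePolynomial numbering G)

  private
    infixl 8 _⟪_⟫
    _⟪_⟫ : ∀ {a b} → Vec.Vec Bool b → (Fin a → Fin b) → Vec.Vec Bool a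
    x ⟪ σ ⟫ = Vec.tabulate (λ i → Vec.lookup x (σ i))

    lookup-⟪⟫ : ∀ {a b} (x : Vec.Vec Bool b) (σ : Fin a → Fin b) → ∀ i → Vec.lookup (x ⟪ σ ⟫) i ≡ Vec.lookup x (σ i)
    lookup-⟪⟫ x σ = Vec.lookup∘tabulate (Vec.lookup x ∘ σ)

    F-q : ∀ {m} (x : Vec.Vec Bool m) (σ : Fin n → Fin m) → apply F (x ⟪ σ ⟫) ≡ q (Vec.lookup x ∘ σ ∘ e)
    F-q x σ = trans (apply-polynomial numbering G (Vec.lookup x ∘ σ)) (f-q (Vec.lookup x ∘ σ))

    fin : ∀ n → .{{NonZero n}} → Fin n
    fin (suc _) = zero

    -- If `σ` were injective on the essential variables, it could be undone there, and `F` would be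
    -- a minor of `g`.
    collide : ∀ g (g≺F : g ≺ F) → ∃[ i ] ∃[ j ] (i ≢ j × proj₁ (proj₁ g≺F) (e i) ≡ proj₁ (proj₁ g≺F) (e j))
    collide g ((σ , g-F) , F⋠g) with Fin.any? (λ i → Fin.any? (λ j → ¬? (i ≟ j) ×-dec (σ (e i) ≟ σ (e j))))
    ... | yes p = p
    ... | no ¬p = ⊥-elim (F⋠g (β , λ x → sym (begin
          apply g (x ⟪ β ⟫)                        ≡⟨ g-F (x ⟪ β ⟫) ⟩
          apply F (x ⟪ β ⟫ ⟪ σ ⟫)                  ≡⟨ F-q (x ⟪ β ⟫) σ ⟩
          q (Vec.lookup (x ⟪ β ⟫) ∘ σ ∘ e)         ≡⟨ q-cong (λ t → trans (lookup-⟪⟫ x β (σ (e t)))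
                                                        (cong (Vec.lookup x) (proj₂ ext t))) ⟩
          q (Vec.lookup x ∘ e)                     ≡⟨ f-q (Vec.lookup x) ⟨
          apply F x ∎)))
      where
      open ≡-Reasoning
      injective : ∀ {s t} → σ (e s) ≡ σ (e t) → s ≡ t
      injective {s} {t} eq with s ≟ t
      ... | yes s≡t = s≡t
      ... | no  s≢t = contradiction (s , t , s≢t , eq) ¬p
      -- `β` undoes `σ` on the essential variables. The default `fin n` used elsewhere is harmless,
      -- because `F` reads only variables in the image of `e`.
      ext = extension (σ ∘ e) injective (fin n) e
      β = proj₁ ext

    module _ (i₀ : Fin N) where

      N-nonZero : ∀ {N} → Fin N → NonZero N
      N-nonZero zero    = _
      N-nonZero (suc _) = _

      instance
        _ : NonZero N
        _ = N-nonZero i₀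

      -- All `N` variables are kept, and `k` becomes inessential instead of being deleted. The
      -- vertex `i₀` certifies that the arity is nonzero.
      merged : Fin N → Fin N → BooleanFunction
      merged k l = booleanFunction N (λ y → q (Vec.lookup y ∘ merge k l))

      retraction : Σ[ r ∈ (Fin n → Fin N) ] (∀ t → r (e t) ≡ t)
      retraction = extension e e-injective i₀ id

      r = proj₁ retraction

      -- For strictness: if `F` were a minor of the merged function, `q` would reproduce itself
      -- along a map factoring through `merge k l`. By `reproduce-surjective` that map is onto,
      -- hence injective, yet it identifies `k` with `l`.
      merged≺F : ∀ {k l} → k ≢ l → merged k l ≺ F
      merged≺F {k} {l} k≢l = (merge k l ∘ r , λ y → sym (trans (F-q y (merge k l ∘ r))
          (q-cong (λ t → cong (Vec.lookup y ∘ merge k l) (proj₂ retraction t)))))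
        , λ (σ , F-m) → k≢l (surjective⇒injective _ (reproduce-surjective Q neighbour (r ∘ σ ∘ merge k l) (same σ F-m))
            (cong (r ∘ σ) (trans (merge-here k l) (sym (merge-there k l)))))
        where
        same : (σ : Fin N → Fin n) →
          (∀ x → apply F x ≡ q (Vec.lookup (x ⟪ σ ⟫) ∘ merge k l)) → ∀ y → q y ≡ q (y ∘ r ∘ σ ∘ merge k l)
        same σ F-m y = begin
          q y                                   ≡⟨ q-cong (λ t → cong y (proj₂ retraction t)) ⟨
          q (y ∘ r ∘ e)                         ≡⟨ q-cong (λ t → Vec.lookup∘tabulate (y ∘ r) (e t)) ⟨
          q (Vec.lookup x ∘ e)                  ≡⟨ f-q (Vec.lookup x) ⟨
          apply F x                             ≡⟨ F-m x ⟩
          q (Vec.lookup (x ⟪ σ ⟫) ∘ merge k l)  ≡⟨ q-cong (λ t → trans (lookup-⟪⟫ x σ (merge k l t))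
                                                     (Vec.lookup∘tabulate (y ∘ r) (σ (merge k l t)))) ⟩
          q (y ∘ r ∘ σ ∘ merge k l)             ∎
          where
          open ≡-Reasoning
          x = Vec.tabulate (y ∘ r)

  -- The pair is one that the lower cover `f′` identifies. Merging `k` and `l` gives a strict minor
  -- of `F`, hence a minor of `f′`, and the composite substitution identifies `i` and `j`. Every `τ`
  -- in question factors through `merge k l`, so this case yields all others.
  irreducible⇒greatest : Irreducible F → Greatest q
  irreducible⇒greatest (f′ , f′≺F@((σ₀ , f′-F) , _) , greatest) with collide f′ f′≺F
  ... | i , j , i≢j , σi≡σj = i , j , i≢j , λ k l k≢l τ τk≡τl → dominate k l k≢l τ τk≡τl
    where
    dominate : ∀ k l → k ≢ l → Dominates q i j k l
    dominate k l k≢l τ τk≡τl with greatest (merged i k l) (merged≺F i k≢l)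
    ... | σ₁ , m-f′ = τ ∘ σ₁ ∘ σ₀ ∘ e , cong (τ ∘ σ₁) σi≡σj , λ y → begin
          q (y ∘ τ)                             ≡⟨ q-cong (λ t → cong y (merge-absorb τ τk≡τl t)) ⟨
          q (y ∘ τ ∘ merge k l)                 ≡⟨ q-cong (λ t → Vec.lookup∘tabulate (y ∘ τ) (merge k l t)) ⟨
          q (Vec.lookup (x y) ∘ merge k l)      ≡⟨ m-f′ (x y) ⟩
          apply f′ (x y ⟪ σ₁ ⟫)                 ≡⟨ f′-F (x y ⟪ σ₁ ⟫) ⟩
          apply F (x y ⟪ σ₁ ⟫ ⟪ σ₀ ⟫)           ≡⟨ F-q (x y ⟪ σ₁ ⟫) σ₀ ⟩
          q (Vec.lookup (x y ⟪ σ₁ ⟫) ∘ σ₀ ∘ e)  ≡⟨ q-cong (λ t → trans (lookup-⟪⟫ (x y) σ₁ (σ₀ (e t)))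
                                                     (Vec.lookup∘tabulate (y ∘ τ) (σ₁ (σ₀ (e t))))) ⟩
          q (y ∘ τ ∘ σ₁ ∘ σ₀ ∘ e)               ∎
      where
      open ≡-Reasoning
      x : Point N → Vec.Vec Bool N
      x y = Vec.tabulate (y ∘ τ)

  -- The lower cover is `F` with `i` and `j` merged. A strict minor identifies some `k` and `l`;
  -- domination rewrites it along a map that identifies `i` and `j`, and such a map factors through
  -- `merge i j`.
  greatest⇒irreducible : Greatest q → Irreducible F
  greatest⇒irreducible (i , j , i≢j , dominates) = merged i i j , merged≺F i i≢j , below
    where
    below : ∀ g → g ≺ F → g ≼ merged i i j
    below g g≺F@((σ , g-F) , _) with collide g g≺F
    ... | k , l , k≢l , σk≡σl with dominates k l k≢l (merge k l) (trans (merge-here k l) (sym (merge-there k l)))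
    ... | σ′ , σ′i≡σ′j , same = σ ∘ e ∘ σ′ , λ x → begin
          apply g x
            ≡⟨ trans (g-F x) (F-q x σ) ⟩
          q (Vec.lookup x ∘ σ ∘ e)
            ≡⟨ q-cong (λ t → cong (Vec.lookup x) (merge-absorb (σ ∘ e) σk≡σl t)) ⟨
          q (Vec.lookup x ∘ σ ∘ e ∘ merge k l)
            ≡⟨ same (Vec.lookup x ∘ σ ∘ e) ⟩
          q (Vec.lookup x ∘ σ ∘ e ∘ σ′)
            ≡⟨ q-cong (λ t → cong (Vec.lookup x ∘ σ ∘ e) (merge-absorb σ′ σ′i≡σ′j t)) ⟨
          q (Vec.lookup x ∘ σ ∘ e ∘ σ′ ∘ merge i j)
            ≡⟨ q-cong (λ t → lookup-⟪⟫ x (σ ∘ e ∘ σ′) (merge i j t)) ⟨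
          q (Vec.lookup (x ⟪ σ ∘ e ∘ σ′ ⟫) ∘ merge i j) ∎
      where open ≡-Reasoning

-- Dominating moves

-- Pulled back along `σ`, a flip at `u` becomes one flip for each preimage of `u`. Fibres of one and
-- two elements suffice for maps that identify a single pair.
fibre₁ : ∀ {m n} (σ : Fin m → Fin n) {u s} → σ s ≡ u → (∀ r → σ r ≡ u → r ≡ s) →
  ∀ y → flip y u ∘ σ ≗ flip (y ∘ σ) s
fibre₁ σ {u} {s} σs≡u only y r with s ≟ r
... | yes refl = cong (y (σ s) xor_) (trans (cong (δ u) σs≡u) (δ-refl u))
... | no  s≢r  = cong (y (σ r) xor_) (δ-≢ λ u≡ → s≢r (sym (only r (sym u≡))))

fibre₂ : ∀ {m n} (σ : Fin m → Fin n) {u s t} → s ≢ t → σ s ≡ u → σ t ≡ u → (∀ r → σ r ≡ u → r ≡ s ⊎ r ≡ t) →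
  ∀ y → flip y u ∘ σ ≗ flip (flip (y ∘ σ) s) t
fibre₂ σ {u} {s} {t} s≢t σs≡u σt≡u only y r = trans (cong (y (σ r) xor_) δ≡) (sym (Bool.xor-assoc (y (σ r)) _ _))
  where
  δ≡ : δ u (σ r) ≡ δ s r xor δ t r
  δ≡ with s ≟ r | t ≟ r
  ... | yes refl | yes refl = contradiction refl s≢t
  ... | yes refl | no _     = trans (cong (δ u) σs≡u) (δ-refl u)
  ... | no _     | yes refl = trans (cong (δ u) σt≡u) (δ-refl u)
  ... | no s≢r   | no t≢r   = δ-≢ λ u≡ → [ s≢r ∘ sym , t≢r ∘ sym ]′ (only r (sym u≡))

module _ {N} (B : Graph (Fin N)) where

  private
    A : Adjacency N
    A = adj B

  Apex : (k l v : Fin N) → Set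
  Apex k l v = A v k ≡ true × A v l ≡ true × (∀ w → w ≢ k → w ≢ l → A v w ≡ false)

  Apex? : ∀ k l v → Dec (Apex k l v)
  Apex? k l v = (A v k Bool.≟ true) ×-dec ((A v l Bool.≟ true) ×-dec
    Fin.all? (λ w → ¬? (w ≟ k) →-dec (¬? (w ≟ l) →-dec (A v w Bool.≟ false))))

  -- Equivalently, k and l are non-adjacent with the same neighbours.
  FalseTwins : (k l : Fin N) → Set
  FalseTwins k l = ∀ w → A k w ≡ A l w

  Twins : (k l : Fin N) → Set
  Twins k l = ∀ w → w ≢ k → w ≢ l → A k w ≡ A l w

module Moves {N} (B : Graph (Fin N)) {q : Point N → Bool} (Q : Quadratic (adj B) q) where

  open Quadratic Q public

  A : Adjacency N
  A = adj B

  A-sym : ∀ u v → A u v ≡ A v u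
  A-sym = adj-sym B

  A-irrefl : ∀ v → A v v ≡ false
  A-irrefl = adj-irrefl B

  q-flip₂ : ∀ x u v → q (flip (flip x u) v) ≡ ((D v x xor A v u) xor D u x) xor q x
  q-flip₂ x u v = begin
    q (flip (flip x u) v)                     ≡⟨ q-flip Q (flip x u) v ⟩
    D v (flip x u) xor q (flip x u)           ≡⟨ cong₂ _xor_ (D-flip v x u) (q-flip Q x u) ⟩
    (D v x xor A v u) xor (D u x xor q x)     ≡⟨ Bool.xor-assoc (D v x xor A v u) (D u x) (q x) ⟨
    ((D v x xor A v u) xor D u x) xor q x     ∎
    where open ≡-Reasoning

  D-unit : ∀ u v → D u (flip origin v) ≡ A u v
  D-unit u v = trans (D-flip u origin v) (cong (_xor A u v) (D-origin u))

  q-unit : ∀ u → q (flip origin u) ≡ false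
  q-unit u = trans (q-flip Q origin u) (cong₂ _xor_ (D-origin u) q-origin)

  q-pair : ∀ u v → q (flip (flip origin u) v) ≡ A v u
  q-pair u v = trans (q-flip Q (flip origin u) v) (trans (cong₂ _xor_ (D-unit v u) (q-unit u)) (Bool.xor-identityʳ _))

  D-pair : ∀ v k l → D v (flip (flip origin k) l) ≡ A v k xor A v l
  D-pair v k l = trans (D-flip v (flip origin k) l) (cong (_xor A v l) (D-unit v k))

  q-triple : ∀ k l v → q (flip (flip (flip origin k) l) v) ≡ (A v k xor A v l) xor A l k
  q-triple k l v = trans (q-flip Q _ v) (cong₂ _xor_ (D-pair v k l) (q-pair k l))

  -- The first difference at `v` is the linear form whose coefficients are row `v` of `A`, and for
  -- an apex this row is the indicator of `k` and `l`. Identifying `k` and `l` thus makes `v`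
  -- inessential.
  D-apex : ∀ {k l v} → k ≢ l → Apex B k l v → ∀ y → D v y ≡ y k xor y l
  D-apex {k} {l} {v} k≢l (Avk , Avl , others) = point-induction _
    (λ x≗y p → trans (sym (D-cong Q v x≗y)) (trans p (cong₂ _xor_ (x≗y k) (x≗y l)))) (D-origin v)
    (λ x w p → trans (D-flip v x w) (trans (cong₂ _xor_ p (Avw w)) (rearrange (x k) (x l) (δ w k) (δ w l))))
    where
    open xor-∧-Solver
    rearrange : ∀ a b c d → (a xor b) xor (c xor d) ≡ (a xor c) xor (b xor d)
    rearrange = solve 4 (λ a b c d → (a :+ b) :+ (c :+ d) := (a :+ c) :+ (b :+ d)) refl
    Avw : ∀ w → A v w ≡ δ w k xor δ w l
    Avw w with w ≟ k | w ≟ l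
    ... | yes refl | yes refl = contradiction refl k≢l
    ... | yes refl | no _     = Avk
    ... | no _     | yes refl = Avl
    ... | no w≢k   | no w≢l   = others w w≢k w≢l

  -- The rows of `u` and `v` agree elsewhere, and at `u` and `v` themselves they differ by `A u v`,
  -- the diagonal being zero.
  D-twins : ∀ {u v} → u ≢ v → Twins B u v → ∀ y → D u y xor D v y ≡ A u v ∧ (y u xor y v)
  D-twins {u} {v} u≢v twins = point-induction _
    (λ x≗y p → trans (sym (cong₂ _xor_ (D-cong Q u x≗y) (D-cong Q v x≗y))) (trans p
      (cong (A u v ∧_) (cong₂ _xor_ (x≗y u) (x≗y v)))))
    (trans (cong₂ _xor_ (D-origin u) (D-origin v)) (sym (Bool.∧-zeroʳ (A u v))))
    λ x w p → begin
      D u (flip x w) xor D v (flip x w)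
        ≡⟨ cong₂ _xor_ (D-flip u x w) (D-flip v x w) ⟩
      (D u x xor A u w) xor (D v x xor A v w)
        ≡⟨ solve 4 (λ a b c d → (a :+ b) :+ (c :+ d) := (a :+ c) :+ (b :+ d)) refl (D u x) (A u w) (D v x) (A v w) ⟩
      (D u x xor D v x) xor (A u w xor A v w)
        ≡⟨ cong₂ _xor_ p (step w) ⟩
      (A u v ∧ (x u xor x v)) xor (A u v ∧ (δ w u xor δ w v))
        ≡⟨ solve 5 (λ a b c d e → (a :* (b :+ c)) :+ (a :* (d :+ e)) := a :* ((b :+ d) :+ (c :+ e))) refl
             (A u v) (x u) (x v) (δ w u) (δ w v) ⟩
      A u v ∧ (flip x w u xor flip x w v) ∎
    where
    open xor-∧-Solver
    open ≡-Reasoning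
    step : ∀ w → A u w xor A v w ≡ A u v ∧ (δ w u xor δ w v)
    step w with w ≟ u | w ≟ v
    ... | yes refl | yes refl = contradiction refl u≢v
    ... | yes refl | no _     = trans (cong (_xor A v w) (A-irrefl w)) (trans (A-sym v w) (sym (Bool.∧-identityʳ _)))
    ... | no _     | yes refl = trans (cong (A u w xor_) (A-irrefl w))
                                  (trans (Bool.xor-identityʳ _) (sym (Bool.∧-identityʳ _)))
    ... | no w≢u   | no w≢v   = trans (cong (_xor A v w) (twins w w≢u w≢v)) (trans (Bool.xor-same (A v w)) (sym (Bool.∧-zeroʳ _)))

  q-change₁ : ∀ {x x′} v → (∀ t → t ≢ v → x′ t ≡ x t) → D v x ≡ false → q x ≡ q x′
  q-change₁ {x} {x′} v same Dvx with x′ v xor x v in eq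
  ... | false = q-cong agree
    where
    agree : x ≗ x′
    agree t with t ≟ v
    ... | yes refl = sym (trans (sym (xor-cancelʳ (x′ v) (x v))) (cong (_xor x v) eq))
    ... | no  t≢v  = sym (same t t≢v)
  ... | true = trans (sym (trans (q-flip Q x v) (cong (_xor q x) Dvx))) (q-cong agree)
    where
    agree : flip x v ≗ x′
    agree t with v ≟ t
    ... | yes refl = trans (Bool.xor-comm (x v) true) (trans (cong (_xor x v) (sym eq)) (xor-cancelʳ (x′ v) (x v)))
    ... | no  v≢t  = trans (Bool.xor-identityʳ _) (sym (same t (v≢t ∘ sym)))

  -- The balance condition says that both coordinates change or neither does, so `x′` is `x` or its
  -- double flip.
  q-change₂ : ∀ {x x′ u v} → u ≢ v → (∀ t → t ≢ u → t ≢ v → x′ t ≡ x t) → x′ u xor x u ≡ x′ v xor x v →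
    (x′ u xor x u ≡ true → q (flip (flip x u) v) ≡ q x) → q x ≡ q x′
  q-change₂ {x} {x′} {u} {v} u≢v same balanced flips with x′ u xor x u in eq
  ... | false = q-cong agree
    where
    agree : x ≗ x′
    agree t with t ≟ u | t ≟ v
    ... | yes refl | _        = sym (trans (sym (xor-cancelʳ (x′ u) (x u))) (cong (_xor x u) eq))
    ... | no _     | yes refl = sym (trans (sym (xor-cancelʳ (x′ v) (x v))) (cong (_xor x v) (sym balanced)))
    ... | no t≢u   | no t≢v   = sym (same t t≢u t≢v)
  ... | true = trans (sym (flips refl)) (q-cong agree)
    where
    restore : ∀ t → true ≡ x′ t xor x t → x t xor true ≡ x′ t
    restore t eq = trans (Bool.xor-comm (x t) true) (trans (cong (_xor x t) eq) (xor-cancelʳ (x′ t) (x t)))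
    agree : flip (flip x u) v ≗ x′
    agree t with u ≟ t | v ≟ t
    ... | yes refl | yes refl = contradiction refl u≢v
    ... | yes refl | no _     = trans (Bool.xor-identityʳ _) (restore u (sym eq))
    ... | no _     | yes refl = trans (cong (_xor true) (Bool.xor-identityʳ (x v))) (restore v balanced)
    ... | no u≢t   | no v≢t   = trans (Bool.xor-identityʳ _) (trans (Bool.xor-identityʳ _) (sym (same t (u≢t ∘ sym) (v≢t ∘ sym))))

  infix 4 _⊒_

  _⊒_ : Fin N × Fin N → Fin N × Fin N → Set
  (i , j) ⊒ (k , l) = Dominates q i j k l

  ⊒-refl : ∀ {p} → p ⊒ p
  ⊒-refl τ τk≡τl = τ , τk≡τl , λ _ → refl

  ⊒-swap : ∀ {k l} → (k , l) ⊒ (l , k)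
  ⊒-swap τ τl≡τk = τ , sym τl≡τk , λ _ → refl

  ⊒-trans : ∀ {p p′ p″} → p ⊒ p′ → p′ ⊒ p″ → p ⊒ p″
  ⊒-trans d d′ τ τ≡ with d′ τ τ≡
  ... | σ , σ≡ , same with d σ σ≡
  ... | σ′ , σ′≡ , same′ = σ′ , σ′≡ , λ y → trans (same y) (same′ y)

  -- Once `k` and `l` are identified, `D-apex` makes the variable `v` inessential, so `σ` may send
  -- it to `τ w` without changing the value.
  apex-⊒ : ∀ {k l v} → k ≢ l → Apex B k l v → ∀ w → (v , w) ⊒ (k , l)
  apex-⊒ {k} {l} {v} k≢l apex w τ τk≡τl = σ , trans σv (sym σw) ,
    λ y → q-change₁ v (λ t t≢v → cong y (σ-≢ t t≢v)) (trans (D-apex k≢l apex (y ∘ τ))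
      (trans (cong (λ s → y s xor y (τ l)) τk≡τl) (Bool.xor-same (y (τ l)))))
    where
    σ : Fin N → Fin N
    σ t = if δ t v then τ w else τ t
    σv : σ v ≡ τ w
    σv rewrite δ-refl v = refl
    σw : σ w ≡ τ w
    σw with δ w v
    ... | true  = refl
    ... | false = refl
    σ-≢ : ∀ t → t ≢ v → σ t ≡ τ t
    σ-≢ t t≢v rewrite δ-≢ t≢v = refl

  falseTwins⇒nonadjacent : ∀ {k l} → FalseTwins B k l → A k l ≡ false
  falseTwins⇒nonadjacent {k} {l} twins = trans (twins l) (A-irrefl l)

  -- Once `k` and `l` are identified, the contributions of these non-adjacent twins cancel over
  -- GF(2), so `σ` may send both to `τ w`.
  falseTwins-⊒ : ∀ {k l} → k ≢ l → FalseTwins B k l → ∀ w → (k , w) ⊒ (k , l)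
  falseTwins-⊒ {k} {l} k≢l twins w τ τk≡τl = σ , trans σk (sym σw) ,
    λ y → q-change₂ k≢l (λ t t≢k t≢l → cong y (σ-≢ t t≢k t≢l))
      (cong₂ (λ a b → y a xor y b) (trans σk (sym σl)) τk≡τl) (λ _ → unchanged (y ∘ τ) (cong y τk≡τl))
    where
    σ : Fin N → Fin N
    σ t = if δ t k then τ w else (if δ t l then τ w else τ t)
    σk : σ k ≡ τ w
    σk rewrite δ-refl k = refl
    σl : σ l ≡ τ w
    σl rewrite δ-≢ (k≢l ∘ sym) | δ-refl l = refl
    σw : σ w ≡ τ w
    σw with δ w k | δ w l
    ... | true  | _     = refl
    ... | false | true  = refl
    ... | false | false = refl
    σ-≢ : ∀ t → t ≢ k → t ≢ l → σ t ≡ τ t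
    σ-≢ t t≢k t≢l rewrite δ-≢ t≢k | δ-≢ t≢l = refl
    unchanged : ∀ x → x k ≡ x l → q (flip (flip x k) l) ≡ q x
    unchanged x eq = trans (q-flip₂ x k l) (cong (_xor q x) (begin
      (D l x xor A l k) xor D k x   ≡⟨ cong (λ a → (D l x xor a) xor D k x) (trans (A-sym l k) (falseTwins⇒nonadjacent twins)) ⟩
      (D l x xor false) xor D k x   ≡⟨ cong (_xor D k x) (Bool.xor-identityʳ (D l x)) ⟩
      D l x xor D k x               ≡⟨ Bool.xor-comm (D l x) (D k x) ⟩
      D k x xor D l x               ≡⟨ D-twins k≢l (λ w _ _ → twins w) x ⟩
      A k l ∧ (x k xor x l)         ≡⟨ cong (_∧ (x k xor x l)) (falseTwins⇒nonadjacent twins) ⟩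
      false ∎))
      where open ≡-Reasoning

  -- Interchanging twins preserves `q`, so `σ` is `τ` with its values at `u` and `v` interchanged.
  twins-⊒ : ∀ {u v w} → u ≢ v → w ≢ u → w ≢ v → Twins B u v → (u , w) ⊒ (v , w)
  twins-⊒ {u} {v} {w} u≢v w≢u w≢v twins τ τv≡τw = σ , trans σu (trans τv≡τw (sym (σ-≢ w w≢u w≢v))) ,
    λ y → q-change₂ u≢v (λ t t≢u t≢v → cong y (σ-≢ t t≢u t≢v)) (balanced y) (unchanged y)
    where
    σ : Fin N → Fin N
    σ t = if δ t u then τ v else (if δ t v then τ u else τ t)
    σu : σ u ≡ τ v
    σu rewrite δ-refl u = refl
    σv : σ v ≡ τ u
    σv rewrite δ-≢ (u≢v ∘ sym) | δ-refl v = refl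
    σ-≢ : ∀ t → t ≢ u → t ≢ v → σ t ≡ τ t
    σ-≢ t t≢u t≢v rewrite δ-≢ t≢u | δ-≢ t≢v = refl
    balanced : ∀ (y : Point N) → y (σ u) xor y (τ u) ≡ y (σ v) xor y (τ v)
    balanced y = trans (cong (λ a → y a xor y (τ u)) σu)
      (trans (Bool.xor-comm (y (τ v)) (y (τ u))) (cong (λ a → y a xor y (τ v)) (sym σv)))
    -- A double flip occurs only when `x` differs at `u` and `v`. Then the first differences at `u`
    -- and `v` add up to `A u v`, which cancels the second difference.
    unchanged : ∀ y → y (σ u) xor y (τ u) ≡ true → q (flip (flip (y ∘ τ) u) v) ≡ q (y ∘ τ)
    unchanged y differ = trans (q-flip₂ x u v) (cong (_xor q x) (begin
      (D v x xor A v u) xor D u x      ≡⟨ solve 3 (λ a b c → (a :+ b) :+ c := (c :+ a) :+ b) refl (D v x) (A v u) (D u x) ⟩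
      (D u x xor D v x) xor A v u      ≡⟨ cong₂ _xor_ (D-twins u≢v twins x) (A-sym v u) ⟩
      (A u v ∧ (x u xor x v)) xor A u v
        ≡⟨ cong (λ b → (A u v ∧ b) xor A u v)
             (trans (Bool.xor-comm (x u) (x v)) (trans (cong (λ a → y a xor x u) (sym σu)) differ)) ⟩
      (A u v ∧ true) xor A u v         ≡⟨ cong (_xor A u v) (Bool.∧-identityʳ (A u v)) ⟩
      A u v xor A u v                  ≡⟨ Bool.xor-same (A u v) ⟩
      false ∎))
      where
      open ≡-Reasoning
      open xor-∧-Solver
      x = y ∘ τ

  automorphism-⊒ : (π : Fin N → Fin N) → (∀ v → ∃[ t ] π t ≡ v) → (∀ u v → A (π u) (π v) ≡ A u v) →
    ∀ {i j} → (i , j) ⊒ (π i , π j)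
  automorphism-⊒ π surj π-adj τ τ≡ = τ ∘ π , τ≡ ,
    λ y → pullback B B Q Q π (surjective⇒injective π surj) π-adj (λ v _ _ → surj v) (y ∘ τ)

-- Comparison of two pairs

module Comparison {N} (B : Graph (Fin N)) {q : Point N → Bool} (Q : Quadratic (adj B) q)
  (neighbour : ∀ v → ∃[ u ] adj B v u ≡ true) {i j k l : Fin N} (i≢j : i ≢ j) (k≢l : k ≢ l)
  (dominates : Dominates q i j k l) (¬apex : ∀ v → ¬ Apex B k l v) (¬twins : ¬ FalseTwins B k l) where

  open Moves B Q

  private
    l≢k : l ≢ k
    l≢k = k≢l ∘ sym

    only-l : ∀ r → merge k l r ≡ l → r ≡ k ⊎ r ≡ l
    only-l r eq with r ≟ k
    ... | yes r≡k = inj₁ r≡k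
    ... | no  _   = inj₂ eq

    merge-only : ∀ {u} → u ≢ l → ∀ r → merge k l r ≡ u → r ≡ u
    merge-only u≢l r eq with r ≟ k
    ... | yes _ = contradiction (sym eq) u≢l
    ... | no  _ = eq

    merge-l : ∀ y → flip y l ∘ merge k l ≗ flip (flip (y ∘ merge k l) k) l
    merge-l = fibre₂ (merge k l) k≢l (merge-here k l) (merge-there k l) only-l

    merge-other : ∀ {u} → u ≢ k → u ≢ l → ∀ y → flip y u ∘ merge k l ≗ flip (y ∘ merge k l) u
    merge-other u≢k u≢l = fibre₁ (merge k l) (merge-≢ u≢k) (merge-only u≢l)

    -- `merge k l` is the universal map identifying `k` and `l`, so domination is applied to it
    -- alone.
    d = dominates (merge k l) (trans (merge-here k l) (sym (merge-there k l)))

    σ : Fin N → Fin N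
    σ = proj₁ d

    σi≡σj : σ i ≡ σ j
    σi≡σj = proj₁ (proj₂ d)

    same : ∀ y → q (y ∘ merge k l) ≡ q (y ∘ σ)
    same = proj₂ (proj₂ d)

    -- A flip at a vertex missed by `σ` is invisible on the right of `same`, hence also on the left;
    -- on points with equal values at `k` and `l` merging has no effect.
    unchanged : ∀ {u} → (∀ t → σ t ≢ u) → ∀ x → x k ≡ x l → q (flip x u ∘ merge k l) ≡ q x
    unchanged {u} off x xk≡xl = begin
      q (flip x u ∘ merge k l)   ≡⟨ same (flip x u) ⟩
      q (flip x u ∘ σ)           ≡⟨ q-cong (flip-off x σ off) ⟩
      q (x ∘ σ)                  ≡⟨ same x ⟨
      q (x ∘ merge k l)          ≡⟨ q-cong (merge-absorb x xk≡xl) ⟩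
      q x                        ∎
      where open ≡-Reasoning

    cancel : ∀ {a b} → a xor b ≡ b → a ≡ false
    cancel {a} {b} eq = trans (sym (xor-cancelʳ a b)) (trans (cong (_xor b) eq) (Bool.xor-same b))

    equal : ∀ {a b} → a xor b ≡ false → a ≡ b
    equal {a} {b} eq = trans (sym (xor-cancelʳ a b)) (cong (_xor b) eq)

    -- If `l` were missed, the merged variable would be inessential. The origin then shows that `k`
    -- and `l` are not adjacent, and the unit points show that their rows agree.
    l-hit : ¬ (∀ t → σ t ≢ l)
    l-hit off = ¬twins twins
      where
      D-l : ∀ x → x k ≡ x l → (D l x xor A l k) xor D k x ≡ false
      D-l x xk≡xl = cancel (trans (sym (q-flip₂ x k l)) (trans
        (q-cong (λ t → trans (flip-cong (flip-cong (λ s → sym (merge-absorb x xk≡xl s)) k) l t) (sym (merge-l x t))))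
        (unchanged off x xk≡xl)))
      Alk : A l k ≡ false
      Alk = trans (sym (Bool.xor-identityʳ (A l k)))
        (trans (sym (cong₂ (λ a b → (a xor A l k) xor b) (D-origin l) (D-origin k))) (D-l origin refl))
      twins : FalseTwins B k l
      twins w with w ≟ k | w ≟ l
      ... | yes refl | _        = trans (A-irrefl k) (sym Alk)
      ... | no _     | yes refl = trans (A-sym k l) (trans Alk (sym (A-irrefl l)))
      ... | no w≢k   | no w≢l   = sym (equal (trans (sym (cong₂ _xor_
              (trans (cong (D l x xor_) Alk) (trans (Bool.xor-identityʳ _) (D-unit l w))) (D-unit k w)))
              (D-l x (cong (false xor_) (trans (δ-≢ w≢k) (sym (δ-≢ w≢l)))))))
        where x = flip origin w

    -- If `u` were missed, its first difference would vanish on all points with equal values at `k`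
    -- and `l`. Unit points exclude neighbours other than `k` and `l`, the sum of the unit points at
    -- `k` and `l` shows that `u` sees both or neither, and `neighbour` excludes neither, so `u`
    -- would be an apex.
    other-hit : ∀ {u} → u ≢ k → u ≢ l → ¬ (∀ t → σ t ≢ u)
    other-hit {u} u≢k u≢l off with neighbour u
    ... | w , Auw = ¬apex u (Auk , trans (sym Auk≡Aul) Auk , others)
      where
      D-u : ∀ x → x k ≡ x l → D u x ≡ false
      D-u x xk≡xl = trans (cong (_xor q x) (trans
        (q-cong (λ t → trans (flip-cong (λ s → sym (merge-absorb x xk≡xl s)) u t) (sym (merge-other u≢k u≢l x t))))
        (unchanged off x xk≡xl))) (Bool.xor-same (q x))
      others : ∀ w → w ≢ k → w ≢ l → A u w ≡ false
      others w w≢k w≢l = trans (sym (D-unit u w)) (D-u (flip origin w) (trans (δ-≢ w≢k) (sym (δ-≢ w≢l))))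
      Auk≡Aul : A u k ≡ A u l
      Auk≡Aul = equal (trans (sym (D-pair u k l)) (D-u (flip (flip origin k) l)
        (trans (cong₂ _xor_ (δ-refl k) (δ-≢ l≢k)) (sym (cong₂ _xor_ (δ-≢ k≢l) (δ-refl l))))))
      Auk : A u k ≡ true
      Auk with w ≟ k | w ≟ l
      ... | yes refl | _        = Auw
      ... | no _     | yes refl = trans Auk≡Aul Auw
      ... | no w≢k   | no w≢l   = contradiction (trans (sym Auw) (others w w≢k w≢l)) λ ()

    hit : ∀ u → u ≢ k → ∃[ t ] σ t ≡ u
    hit u u≢k with Fin.any? (λ t → σ t ≟ u)
    ... | yes p = p
    ... | no ¬p with u ≟ l
    ...   | yes refl = ⊥-elim (l-hit λ t eq → ¬p (t , eq))
    ...   | no  u≢l  = ⊥-elim (other-hit u≢k u≢l λ t eq → ¬p (t , eq))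

  -- σ misses only k and identifies only i with j, so sending j to k instead gives a permutation.
  π : Fin N → Fin N
  π t = if δ t j then k else σ t

  private
    π-j : π j ≡ k
    π-j rewrite δ-refl j = refl

    π-≢ : ∀ {t} → t ≢ j → π t ≡ σ t
    π-≢ t≢j rewrite δ-≢ t≢j = refl

  π-surjective : ∀ v → ∃[ t ] π t ≡ v
  π-surjective v with v ≟ k
  ... | yes refl = j , π-j
  ... | no  v≢k with hit v v≢k
  ...   | t , σt≡v with t ≟ j
  ...     | yes refl = i , trans (π-≢ i≢j) (trans σi≡σj σt≡v)
  ...     | no  t≢j  = t , trans (π-≢ t≢j) σt≡v

  π-injective : ∀ {s t} → π s ≡ π t → s ≡ t
  π-injective = surjective⇒injective π π-surjective

  ρ : Fin N → Fin N
  ρ v = proj₁ (π-surjective v)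

  π-ρ : ∀ v → π (ρ v) ≡ v
  π-ρ v = proj₂ (π-surjective v)

  ρ-π : ∀ t → ρ (π t) ≡ t
  ρ-π t = π-injective (π-ρ (π t))

  private
    a : Fin N
    a = σ i

    πi≡a : π i ≡ a
    πi≡a = π-≢ i≢j

    a≢k : a ≢ k
    a≢k a≡k = i≢j (π-injective (trans πi≡a (trans a≡k (sym π-j))))

    σ-a : ∀ y → flip y a ∘ σ ≗ flip (flip (y ∘ σ) i) j
    σ-a = fibre₂ σ i≢j refl (sym σi≡σj) only
      where
      only : ∀ r → σ r ≡ a → r ≡ i ⊎ r ≡ j
      only r eq with r ≟ j
      ... | yes r≡j = inj₂ r≡j
      ... | no  r≢j = inj₁ (π-injective (trans (π-≢ r≢j) (trans eq (sym πi≡a))))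

    σ-other : ∀ {u} → u ≢ k → u ≢ a → ∀ y → flip y u ∘ σ ≗ flip (y ∘ σ) (ρ u)
    σ-other {u} u≢k u≢a = fibre₁ σ (trans (sym (π-≢ ρu≢j)) (π-ρ u)) only
      where
      ρu≢j : ρ u ≢ j
      ρu≢j eq = u≢k (trans (sym (π-ρ u)) (trans (cong π eq) π-j))
      only : ∀ r → σ r ≡ u → r ≡ ρ u
      only r eq with r ≟ j
      ... | yes refl = contradiction (trans (sym eq) (sym σi≡σj)) u≢a
      ... | no  r≢j  = π-injective (trans (π-≢ r≢j) (trans eq (sym (π-ρ u))))

    at-l : q (flip origin l ∘ merge k l) ≡ A l k
    at-l = trans (q-cong (merge-l origin)) (q-pair k l)

    at-a : q (flip origin a ∘ σ) ≡ A j i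
    at-a = trans (q-cong (σ-a origin)) (q-pair i j)

    -- Evaluate `same` at unit points: a vertex with one preimage gives zero, one with two preimages
    -- gives their adjacency. The two-element fibre lies over `l` for `merge k l` and over `a` for
    -- `σ`; if `a` is not `l`, both adjacencies are therefore false.
    adj-kl-ij : (A l k ≡ A j i) × (A l k ≡ true → a ≡ l)
    adj-kl-ij with a ≟ l
    ... | yes a≡l = trans (sym at-l) (trans (same (flip origin l)) (trans (cong (λ u → q (flip origin u ∘ σ)) (sym a≡l)) at-a)) , λ _ → a≡l
    ... | no  a≢l = trans Alk (sym Aji) , λ Alk′ → contradiction (trans (sym Alk) Alk′) λ ()
      where
      Alk : A l k ≡ false
      Alk = trans (sym at-l) (trans (same (flip origin l)) (trans (q-cong (σ-other l≢k (a≢l ∘ sym) origin)) (q-unit (ρ l))))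
      Aji : A j i ≡ false
      Aji = trans (sym at-a) (trans (sym (same (flip origin a))) (trans (q-cong (merge-other a≢k a≢l origin)) (q-unit a)))

  same-adjacency : A k l ≡ A i j
  same-adjacency = trans (A-sym k l) (trans (proj₁ adj-kl-ij) (A-sym j i))

  -- This lets `ρ` match the vertices distinguished by the two pairs, so that they can be counted
  -- against each other. For `v` other than `k` and `l`, compare `same` at the sum of the unit
  -- points at `l` and `v`; the equal adjacencies within the pairs cancel.
  same-distinguished : A k l ≡ true → ∀ v → A k v xor A l v ≡ A i (ρ v) xor A j (ρ v)
  same-distinguished Akl v = go (v ≟ k) (v ≟ l)
    where
    go : Dec (v ≡ k) → Dec (v ≡ l) → A k v xor A l v ≡ A i (ρ v) xor A j (ρ v)
    go (yes refl) _ = begin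
          A k k xor A l k            ≡⟨ cong₂ _xor_ (A-irrefl k) (proj₁ adj-kl-ij) ⟩
          A j i                      ≡⟨ A-sym j i ⟩
          A i j                      ≡⟨ Bool.xor-identityʳ (A i j) ⟨
          A i j xor false            ≡⟨ cong (A i j xor_) (A-irrefl j) ⟨
          A i j xor A j j            ≡⟨ cong (λ t → A i t xor A j t) (π-injective (trans (π-ρ k) (sym π-j))) ⟨
          A i (ρ k) xor A j (ρ k)    ∎
          where open ≡-Reasoning
    go (no _) (yes refl) = begin
          A k l xor A l l            ≡⟨ cong (A k l xor_) (A-irrefl l) ⟩
          A k l xor false            ≡⟨ Bool.xor-identityʳ (A k l) ⟩
          A k l                      ≡⟨ trans same-adjacency (A-sym i j) ⟩
          A j i                      ≡⟨ cong (_xor A j i) (A-irrefl i) ⟨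
          A i i xor A j i            ≡⟨ cong (λ t → A i t xor A j t) (π-injective (trans (π-ρ l) (sym (trans πi≡a a≡l)))) ⟨
          A i (ρ l) xor A j (ρ l)    ∎
          where
          open ≡-Reasoning
          a≡l : a ≡ l
          a≡l = proj₂ adj-kl-ij (trans (A-sym l k) Akl)
    go (no v≢k) (no v≢l) = trans (cong₂ _xor_ (A-sym k v) (A-sym l v))
          (trans (xor-cancel-common (trans (sym left) (trans (same y) right)) (proj₁ adj-kl-ij))
          (cong₂ _xor_ (A-sym (ρ v) i) (A-sym (ρ v) j)))
          where
          a≡l : a ≡ l
          a≡l = proj₂ adj-kl-ij (trans (A-sym l k) Akl)
          y = flip (flip origin l) v
          left : q (y ∘ merge k l) ≡ (A v k xor A v l) xor A l k
          left = trans (q-cong (λ t → trans (merge-other v≢k v≢l (flip origin l) t) (flip-cong (merge-l origin) v t)))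
            (q-triple k l v)
          σ-l : flip origin l ∘ σ ≗ flip (flip origin i) j
          σ-l t = trans (cong (λ u → flip origin u (σ t)) (sym a≡l)) (σ-a origin t)
          right : q (y ∘ σ) ≡ (A (ρ v) i xor A (ρ v) j) xor A j i
          right = trans (q-cong (λ t → trans (σ-other v≢k (λ v≡a → v≢l (trans v≡a a≡l)) (flip origin l) t)
            (flip-cong σ-l (ρ v) t))) (q-triple i j (ρ v))
          xor-cancel-common : ∀ {a b c d} → a xor c ≡ b xor d → c ≡ d → a ≡ b
          xor-cancel-common {a} {b} {c} eq refl = trans (sym (xor-cancelʳ a c)) (trans (cong (_xor c) eq) (xor-cancelʳ b c))

-- Counting, classes and copies

indicator : Bool → ℕ
indicator b = if b then 1 else 0

count : ∀ {n} → (Fin n → Bool) → ℕ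
count P = sum (indicator ∘ P)

record Enumeration {n} (P : Fin n → Bool) (m : ℕ) : Set where
  field
    elt           : Fin m → Fin n
    elt-injective : ∀ {s t} → elt s ≡ elt t → s ≡ t
    sound         : ∀ t → P (elt t) ≡ true
    complete-elt  : ∀ v → P v ≡ true → ∃[ t ] elt t ≡ v

enumerate : ∀ {n} (P : Fin n → Bool) → Enumeration P (count P)
enumerate {zero}  P = record { elt = λ () ; elt-injective = λ { {()} } ; sound = λ () ; complete-elt = λ () }
enumerate {suc n} P with P zero in P0
... | true  = record
  { elt           = λ { zero → zero ; (suc t) → suc (elt t) }
  ; elt-injective = λ { {zero} {zero} _ → refl ; {suc s} {suc t} eq → cong suc (elt-injective (Fin.suc-injective eq)) }
  ; sound         = λ { zero → P0 ; (suc t) → sound t }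
  ; complete-elt  = λ { zero _ → zero , refl
                      ; (suc v) Pv → suc (proj₁ (complete-elt v Pv)) , cong suc (proj₂ (complete-elt v Pv)) }
  }
  where open Enumeration (enumerate (P ∘ suc))
... | false = record
  { elt           = suc ∘ elt
  ; elt-injective = elt-injective ∘ Fin.suc-injective
  ; sound         = sound
  ; complete-elt  = λ { zero P0′ → contradiction (trans (sym P0) P0′) λ ()
                      ; (suc v) Pv → proj₁ (complete-elt v Pv) , cong suc (proj₂ (complete-elt v Pv)) }
  }
  where open Enumeration (enumerate (P ∘ suc))

nonempty : ∀ {n} → Fin n → 1 ≤ n
nonempty zero    = s≤s z≤n
nonempty (suc _) = s≤s z≤n

two-elements : ∀ {n} {a b : Fin n} → a ≢ b → 2 ≤ n
two-elements {a = zero}  {zero}  a≢b = contradiction refl a≢b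
two-elements {a = zero}  {suc b} _   = s≤s (nonempty b)
two-elements {a = suc a} {_}     _   = s≤s (nonempty a)

two-members : ∀ {n m} {P : Fin n → Bool} → Enumeration P m → ∀ {u v} → P u ≡ true → P v ≡ true → u ≢ v → 2 ≤ m
two-members E {u} {v} Pu Pv u≢v = two-elements
  {a = proj₁ (complete-elt u Pu)} {proj₁ (complete-elt v Pv)}
  λ eq → u≢v (trans (sym (proj₂ (complete-elt u Pu))) (trans (cong elt eq) (proj₂ (complete-elt v Pv))))
  where open Enumeration E

-- A canonical choice depending only on the values of `P`, so that related vertices get the same
-- representative. If `P` holds nowhere, the value is the last index.
first : ∀ {n} → (Fin (suc n) → Bool) → Fin (suc n)
first {zero}  P = zero
first {suc n} P = if P zero then zero else suc (first (P ∘ suc))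

first-true : ∀ {n} (P : Fin (suc n) → Bool) v → P v ≡ true → P (first P) ≡ true
first-true {zero}  P zero Pv = Pv
first-true {suc n} P v Pv with P zero in P0
... | true  = P0
first-true {suc n} P zero    Pv | false = contradiction (trans (sym P0) Pv) λ ()
first-true {suc n} P (suc v) Pv | false = first-true (P ∘ suc) v Pv

first-cong : ∀ {n} {P Q : Fin (suc n) → Bool} → P ≗ Q → first P ≡ first Q
first-cong {zero}  P≗Q = refl
first-cong {suc n} P≗Q = cong₂ (λ b v → if b then zero else suc v) (P≗Q zero) (first-cong (P≗Q ∘ suc))

both-true : ∀ {a b} → (a ≡ true → b ≡ true) → (b ≡ true → a ≡ true) → a ≡ b
both-true {true}          f g = sym (f refl)
both-true {false} {true}  f g = g refl
both-true {false} {false} f g = refl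

record Cells {N} (R : Fin N → Fin N → Bool) (r k : ℕ) : Set where
  field
    cell            : Fin r × Fin k → Fin N
    cell-injective  : ∀ {s t} → cell s ≡ cell t → s ≡ t
    cell-surjective : ∀ v → ∃[ s ] cell s ≡ v
    R-cell          : ∀ s t → R (cell s) (cell t) ≡ δ (proj₁ s) (proj₁ t)

two-cells : ∀ {N r k} {R : Fin N → Fin N → Bool} → Cells R r k → ∀ {u v} → R u v ≡ false → 2 ≤ r
two-cells C {u} {v} Ruv with Cells.cell-surjective C u | Cells.cell-surjective C v
... | s , refl | t , refl = two-elements {a = proj₁ s} {proj₁ t} λ eq →
  contradiction (trans (sym Ruv) (trans (Cells.R-cell C s t) (trans (cong (δ (proj₁ s)) (sym eq)) (δ-refl (proj₁ s))))) λ ()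

-- The first element of a class represents it, so the fixed points of `rep` number the classes, and
-- the enumeration of the class of each root gives the second coordinate. The empty vertex set is
-- treated apart because `first` must return some vertex.
cells : ∀ {N k} (R : Fin N → Fin N → Bool) → (∀ v → R v v ≡ true) → (∀ u v → R u v ≡ R v u) →
  (∀ u v w → R u v ≡ true → R v w ≡ true → R u w ≡ true) → (∀ v → Enumeration (R v) k) → ∃[ r ] Cells R r k
cells {zero} R _ _ _ _ = 0 , record
  { cell            = λ { (() , _) }
  ; cell-injective  = λ { {() , _} }
  ; cell-surjective = λ ()
  ; R-cell          = λ { (() , _) }
  }
cells {suc N} {k} R R-refl R-sym R-trans classes = count (λ v → δ (rep v) v) , record
  { cell            = cell
  ; cell-injective  = cell-injective
  ; cell-surjective = cell-surjective
  ; R-cell          = R-cell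
  }
  where
  rep : Fin (suc N) → Fin (suc N)
  rep v = first (R v)
  R-rep : ∀ v → R v (rep v) ≡ true
  R-rep v = first-true (R v) v (R-refl v)
  rep-cong : ∀ {u v} → R u v ≡ true → rep u ≡ rep v
  rep-cong {u} {v} Ruv = first-cong λ w → both-true (R-trans v u w (trans (R-sym v u) Ruv)) (R-trans u v w Ruv)
  open Enumeration (enumerate (λ v → δ (rep v) v))
    renaming (elt to root; elt-injective to root-injective; sound to root-sound; complete-elt to root-complete)
  module C v = Enumeration (classes v)
  cell : Fin (count (λ v → δ (rep v) v)) × Fin k → Fin (suc N)
  cell (a , x) = C.elt (root a) x
  R-root : ∀ a x → R (root a) (cell (a , x)) ≡ true
  R-root a x = C.sound (root a) x
  R-cell : ∀ s t → R (cell s) (cell t) ≡ δ (proj₁ s) (proj₁ t)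
  R-cell (a , x) (b , y) with a ≟ b
  ... | yes refl = R-trans _ (root a) _ (trans (R-sym _ _) (R-root a x)) (R-root a y)
  ... | no  a≢b  = Bool.¬-not λ Rcc → a≢b (root-injective (begin
    root a          ≡⟨ δ-true (root-sound a) ⟨
    rep (root a)    ≡⟨ rep-cong (R-trans _ _ _ (R-root a x) (R-trans _ _ _ Rcc (trans (R-sym _ _) (R-root b y)))) ⟩
    rep (root b)    ≡⟨ δ-true (root-sound b) ⟩
    root b          ∎))
    where open ≡-Reasoning
  cell-injective : ∀ {s t} → cell s ≡ cell t → s ≡ t
  cell-injective {a , x} {b , y} eq with δ-true {u = a} {b} (trans (sym (R-cell (a , x) (b , y)))
                                         (trans (cong (R (cell (a , x))) (sym eq)) (R-refl (cell (a , x)))))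
  ... | refl = cong (a ,_) (C.elt-injective (root a) eq)
  cell-surjective : ∀ v → ∃[ s ] cell s ≡ v
  cell-surjective v with root-complete (rep v) (trans (cong (λ u → δ u (rep v)) (sym (rep-cong (R-rep v)))) (δ-refl (rep v)))
  ... | a , root≡rep with C.complete-elt (root a) v (trans (cong (λ u → R u v) root≡rep) (trans (R-sym (rep v) v) (R-rep v)))
  ... | x , eq = (a , x) , eq

-- Iterated unions and joins, with vertices indexed by pairs

split : ∀ {V : Set} r → Copies r V → Fin r × V
split (suc r) (inj₁ x) = zero , x
split (suc r) (inj₂ c) = suc (proj₁ (split r c)) , proj₂ (split r c)

place : ∀ {V : Set} r → Fin r × V → Copies r V
place (suc r) (zero , x)  = inj₁ x
place (suc r) (suc a , x) = inj₂ (place r (a , x))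

split-place : ∀ {V : Set} r (s : Fin r × V) → split r (place r s) ≡ s
split-place (suc r) (zero , x)  = refl
split-place (suc r) (suc a , x) = cong (λ (a , x) → suc a , x) (split-place r (a , x))

place-split : ∀ {V : Set} r (c : Copies r V) → place r (split r c) ≡ c
place-split (suc r) (inj₁ x) = refl
place-split (suc r) (inj₂ c) = cong inj₂ (place-split r c)

split-injective : ∀ {V : Set} r {c d : Copies r V} → split r c ≡ split r d → c ≡ d
split-injective r {c} {d} eq = trans (sym (place-split r c)) (trans (cong (place r) eq) (place-split r d))

adj-unionOfCopies : ∀ {V : Set} (G : Graph V) r (c d : Copies r V) → adj (unionOfCopies r G) c d ≡
  (if δ (proj₁ (split r c)) (proj₁ (split r d)) then adj G (proj₂ (split r c)) (proj₂ (split r d)) else false)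
adj-unionOfCopies G (suc r) (inj₁ _) (inj₁ _) = refl
adj-unionOfCopies G (suc r) (inj₁ _) (inj₂ _) = refl
adj-unionOfCopies G (suc r) (inj₂ _) (inj₁ _) = refl
adj-unionOfCopies G (suc r) (inj₂ c) (inj₂ d) = adj-unionOfCopies G r c d

adj-joinOfCopies : ∀ {V : Set} (G : Graph V) r (c d : Copies r V) → adj (joinOfCopies r G) c d ≡
  (if δ (proj₁ (split r c)) (proj₁ (split r d)) then adj G (proj₂ (split r c)) (proj₂ (split r d)) else true)
adj-joinOfCopies G (suc r) (inj₁ _) (inj₁ _) = refl
adj-joinOfCopies G (suc r) (inj₁ _) (inj₂ _) = refl
adj-joinOfCopies G (suc r) (inj₂ _) (inj₁ _) = refl
adj-joinOfCopies G (suc r) (inj₂ c) (inj₂ d) = adj-joinOfCopies G r c d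

isomorphism : ∀ {V W : Set} (G : Graph V) (H : Graph W) (p : W → V) → (∀ {s t} → p s ≡ p t → s ≡ t) →
  (∀ v → ∃[ s ] p s ≡ v) → (∀ s t → adj G (p s) (p t) ≡ adj H s t) → G ≅ H
isomorphism G H p injective surjective p-adj =
  mk↔ₛ′ (proj₁ ∘ surjective) p (λ s → injective (proj₂ (surjective (p s)))) (proj₂ ∘ surjective) ,
  λ u v → trans (sym (p-adj _ _)) (cong₂ (adj G) (proj₂ (surjective u)) (proj₂ (surjective v)))

Family : {V : Set} → Graph V → Set
Family G =
    (∃[ k ] (2 ≤ k × G ≅ unionOfCopies k (complete 3)))
  ⊎ (G ≅ cycle 5)
  ⊎ (∃[ m ] (2 ≤ m × G ≅ complete 2 ⋈ edgeless m))
  ⊎ (∃[ k ] (2 ≤ k × G ≅ complete k))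
  ⊎ (∃[ k ] ∃[ m ] (1 ≤ k × k < m × G ≅ edgeless k ⋈ edgeless m))
  ⊎ (∃[ r ] ∃[ k ] (2 ≤ r × 2 ≤ k × G ≅ joinOfCopies r (edgeless k)))

-- Necessity

false≢true : ∀ {b : Bool} → b ≡ false → b ≡ true → ⊥
false≢true refl ()

neighbour-of-apex : ∀ {N} (B : Graph (Fin N)) {k l v w} → Apex B k l v → adj B v w ≡ true → w ≡ k ⊎ w ≡ l
neighbour-of-apex B {k} {l} {v} {w} (_ , _ , others) Avw with w ≟ k | w ≟ l
... | yes w≡k | _       = inj₁ w≡k
... | no _    | yes w≡l = inj₂ w≡l
... | no w≢k  | no w≢l  = contradiction Avw (false≢true (others w w≢k w≢l))

adjacent⇒distinct : ∀ {V : Set} (G : Graph V) {u v} → adj G u v ≡ true → u ≢ v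
adjacent⇒distinct G {u} Auv refl = false≢true (adj-irrefl G u) Auv

-- Graphs in which every edge has an apex

module Triangles {N} (B : Graph (Fin N)) (neighbour : ∀ v → ∃[ u ] adj B v u ≡ true)
  (edge-apex : ∀ k l → adj B k l ≡ true → ∃[ v ] Apex B k l v) where

  private
    A = adj B
    A-sym = adj-sym B

    -- The apex `w` of the edge from `l` to `v` is a neighbour of `v`, hence `k` or `l`, and it is
    -- not `l`, being adjacent to `l`.
    triangle : ∀ {k l v} → A k l ≡ true → Apex B k l v → Apex B l v k
    triangle {k} {l} {v} Akl apex@(Avk , Avl , _) with edge-apex l v (trans (A-sym l v) Avl)
    ... | w , apex′@(Awl , Awv , _) with neighbour-of-apex B apex (trans (A-sym v w) Awv)
    ...   | inj₁ refl = apex′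
    ...   | inj₂ refl = contradiction Awl (false≢true (adj-irrefl B w))

    Apex-swap : ∀ {k l v} → Apex B k l v → Apex B l k v
    Apex-swap (Avk , Avl , others) = Avl , Avk , λ w w≢l w≢k → others w w≢k w≢l

    R : Fin N → Fin N → Bool
    R u v = δ u v ∨ A u v

    R-adjacent : ∀ {u v} → A u v ≡ true → R u v ≡ true
    R-adjacent {u} {v} Auv = trans (cong (δ u v ∨_) Auv) (Bool.∨-zeroʳ (δ u v))

    R-equal : ∀ {u v} → u ≡ v → R u v ≡ true
    R-equal {u} refl = cong (_∨ A u u) (δ-refl u)

    R-cases : ∀ {u v} → R u v ≡ true → u ≡ v ⊎ A u v ≡ true
    R-cases {u} {v} Ruv with u ≟ v
    ... | yes u≡v = inj₁ u≡v
    ... | no  _   = inj₂ Ruv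

    classes : ∀ v → Enumeration (R v) 3
    classes k with neighbour k
    ... | l , Akl with edge-apex k l Akl
    ... | v , apex@(Avk , Avl , _) = record
      { elt           = elt
      ; elt-injective = λ {s} {t} → injective s t
      ; sound         = λ { zero → R-equal refl ; (suc zero) → R-adjacent Akl ; (suc (suc zero)) → R-adjacent Akv }
      ; complete-elt  = complete-elt
      }
      where
      Akv = trans (A-sym k v) Avk
      k≢l = adjacent⇒distinct B Akl
      k≢v = adjacent⇒distinct B Akv
      v≢l = adjacent⇒distinct B Avl
      elt : Fin 3 → Fin N
      elt zero             = k
      elt (suc zero)       = l
      elt (suc (suc zero)) = v
      injective : ∀ s t → elt s ≡ elt t → s ≡ t
      injective zero             zero             _  = refl
      injective zero             (suc zero)       eq = contradiction eq k≢l
      injective zero             (suc (suc zero)) eq = contradiction eq k≢v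
      injective (suc zero)       zero             eq = contradiction (sym eq) k≢l
      injective (suc zero)       (suc zero)       _  = refl
      injective (suc zero)       (suc (suc zero)) eq = contradiction (sym eq) v≢l
      injective (suc (suc zero)) zero             eq = contradiction (sym eq) k≢v
      injective (suc (suc zero)) (suc zero)       eq = contradiction eq v≢l
      injective (suc (suc zero)) (suc (suc zero)) _  = refl
      complete-elt : ∀ w → R k w ≡ true → ∃[ t ] elt t ≡ w
      complete-elt w Rkw with R-cases Rkw
      ... | inj₁ k≡w = zero , k≡w
      ... | inj₂ Akw with neighbour-of-apex B (triangle Akl apex) Akw
      ...   | inj₁ w≡l = suc zero , sym w≡l
      ...   | inj₂ w≡v = suc (suc zero) , sym w≡v

    R-sym : ∀ u v → R u v ≡ R v u
    R-sym u v = cong₂ _∨_ (both-true (λ eq → trans (cong (δ v) (δ-true eq)) (δ-refl v))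
                                     (λ eq → trans (cong (δ u) (δ-true eq)) (δ-refl u))) (A-sym u v)

    R-trans : ∀ u v w → R u v ≡ true → R v w ≡ true → R u w ≡ true
    R-trans u v w Ruv Rvw with R-cases Ruv | R-cases Rvw
    ... | inj₁ refl | _         = Rvw
    ... | inj₂ _    | inj₁ refl = Ruv
    ... | inj₂ Auv  | inj₂ Avw with edge-apex u v Auv
    -- With `x` the apex of the edge from `u` to `v`, `triangle` leaves `v` only the neighbours `x`
    -- and `u`.
    ...   | x , apex@(Axu , _) with neighbour-of-apex B (Apex-swap (triangle (trans (A-sym v u) Auv) (Apex-swap apex))) Avw
    ...     | inj₁ w≡x  = R-adjacent (trans (A-sym u w) (trans (cong (λ y → A y u) w≡x) Axu))
    ...     | inj₂ w≡u  = R-equal (sym w≡u)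

  union-of-triangles : ∀ {i j} → i ≢ j → A i j ≡ false → ∃[ k ] (2 ≤ k × B ≅ unionOfCopies k (complete 3))
  union-of-triangles {i} {j} i≢j Aij with cells R (λ v → R-equal refl) R-sym R-trans classes
  ... | r , C = r , two-cells C Rij ,
    isomorphism B (unionOfCopies r (complete 3)) (cell ∘ split r) (split-injective r ∘ cell-injective)
      (λ v → place r (proj₁ (cell-surjective v)) , trans (cong cell (split-place r _)) (proj₂ (cell-surjective v)))
      (λ c d → trans (adj-cell (split r c) (split r d)) (sym (adj-unionOfCopies (complete 3) r c d)))
    where
    open Cells C
    Rij : R i j ≡ false
    Rij = cong₂ _∨_ (δ-≢ i≢j) Aij
    adj-cell : ∀ s t → A (cell s) (cell t) ≡ (if δ (proj₁ s) (proj₁ t) then not (δ (proj₂ s) (proj₂ t)) else false)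
    adj-cell (a , x) (b , y) with a ≟ b | R-cell (a , x) (b , y)
    ... | no  _    | Rst = both-true (λ Ast → trans (sym Rst) (R-adjacent Ast)) λ ()
    ... | yes refl | Rst with x ≟ y
    ...   | yes refl = adj-irrefl B _
    ...   | no  x≢y with R-cases Rst
    ...     | inj₁ eq  = contradiction (cong proj₂ (cell-injective eq)) x≢y
    ...     | inj₂ Ast = Ast

-- Failure of transitivity of non-adjacency

module Pentagon {N} (B : Graph (Fin N))
  (nonedge : ∀ k l → k ≢ l → adj B k l ≡ false → (∃[ v ] Apex B k l v) ⊎ FalseTwins B k l)
  {a b c : Fin N} (Aab : adj B a b ≡ false) (Abc : adj B b c ≡ false) (Aac : adj B a c ≡ true) where

  private
    A = adj B
    A-sym = adj-sym B

    symm : ∀ {u v x} → A u v ≡ x → A v u ≡ x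
    symm {u} {v} eq = trans (A-sym v u) eq

    loop : ∀ {v} → A v v ≡ true → ⊥
    loop {v} = false≢true (adj-irrefl B v)

    separate : ∀ {u v w} → A u w ≡ true → A v w ≡ false → u ≢ v
    separate Auw Avw refl = false≢true Avw Auw

    -- The vertex `z` tells `k` and `l` apart, so they are not false twins and `nonedge` must give
    -- an apex.
    apex : ∀ {k l z} → A k l ≡ false → A k z ≡ true → A l z ≡ false → ∃[ v ] Apex B k l v
    apex {k} {l} {z} Akl Akz Alz with nonedge k l (separate Akz Alz) Akl
    ... | inj₁ p     = p
    ... | inj₂ twins = contradiction (trans (sym (twins z)) Akz) (false≢true Alz)

    a≢c : a ≢ c
    a≢c = adjacent⇒distinct B Aac

    b≢c : b ≢ c
    b≢c refl = false≢true Aab Aac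

    a≢b : a ≢ b
    a≢b refl = false≢true Abc Aac

    -- The non-edges at `b` receive apexes: `v` for `a` and `b`, which `c` tells apart, and `w` for
    -- `c` and `b`, which `a` tells apart.
    apex-v : ∃[ v ] Apex B a b v
    apex-v = apex Aab Aac Abc

    v : Fin N
    v = proj₁ apex-v

    Nv : Apex B a b v
    Nv = proj₂ apex-v

    Ava : A v a ≡ true
    Ava = proj₁ Nv

    Avb : A v b ≡ true
    Avb = proj₁ (proj₂ Nv)

    apex-w : ∃[ w ] Apex B c b w
    apex-w = apex (symm Abc) (symm Aac) (symm Aab)

    w : Fin N
    w = proj₁ apex-w

    Nw : Apex B c b w
    Nw = proj₂ apex-w

    Awc : A w c ≡ true
    Awc = proj₁ Nw

    Awb : A w b ≡ true
    Awb = proj₁ (proj₂ Nw)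

    Avc : A v c ≡ false
    Avc = proj₂ (proj₂ Nv) c (a≢c ∘ sym) (b≢c ∘ sym)

    Awa : A w a ≡ false
    Awa = proj₂ (proj₂ Nw) a a≢c a≢b

    Avw : A v w ≡ false
    Avw = proj₂ (proj₂ Nv) w (separate Awb Aab) (λ w≡b → loop (subst (λ x → A x b ≡ true) w≡b Awb))

    -- An apex of `v` and `c` is a neighbour of `v`, hence `a` or `b`, and `b` is not adjacent to
    -- `c`. `Nc` is the mirror image.
    Na : Apex B v c a
    Na with apex Avc Avb (symm Abc)
    ... | x , p@(Axv , Axc , _) with neighbour-of-apex B Nv (symm Axv)
    ...   | inj₁ refl = p
    ...   | inj₂ refl = contradiction Axc (false≢true Abc)

    Nc : Apex B w a c
    Nc with apex Awa Awb Aab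
    ... | x , p@(Axw , Axa , _) with neighbour-of-apex B Nw (symm Axw)
    ...   | inj₁ refl = p
    ...   | inj₂ refl = contradiction (symm Axa) (false≢true Aab)

    p : Fin 5 → Fin N
    p zero                         = v
    p (suc zero)                   = a
    p (suc (suc zero))             = c
    p (suc (suc (suc zero)))       = w
    p (suc (suc (suc (suc zero)))) = b

    -- A further vertex `y` would be adjacent to none of `a`, `v` and `c`. As `v` tells `a` and `y`
    -- apart, they have an apex; being a neighbour of `a`, it is `v` or `c`, neither of which is
    -- adjacent to `y`.
    surjective : ∀ y → ∃[ s ] p s ≡ y
    surjective y with Fin.any? (λ s → p s ≟ y)
    ... | yes hit = hit
    ... | no miss = ⊥-elim absurd
      where
      off : ∀ s → y ≢ p s
      off s eq = miss (s , sym eq)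
      Aay : A a y ≡ false
      Aay = proj₂ (proj₂ Na) y (off zero) (off (suc (suc zero)))
      Avy : A v y ≡ false
      Avy = proj₂ (proj₂ Nv) y (off (suc zero)) (off (suc (suc (suc (suc zero)))))
      Acy : A c y ≡ false
      Acy = proj₂ (proj₂ Nc) y (off (suc (suc (suc zero)))) (off (suc zero))
      absurd : ⊥
      absurd with apex Aay (symm Ava) (symm Avy)
      ... | x , Axa , Axy , _ with neighbour-of-apex B Na (symm Axa)
      ...   | inj₁ refl = false≢true Avy Axy
      ...   | inj₂ refl = false≢true Acy Axy

    p-adj : ∀ s t → A (p s) (p t) ≡ adj (cycle 5) s t
    p-adj zero zero = adj-irrefl B _
    p-adj zero (suc zero) = Ava
    p-adj zero (suc (suc zero)) = Avc
    p-adj zero (suc (suc (suc zero))) = Avw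
    p-adj zero (suc (suc (suc (suc zero)))) = Avb
    p-adj (suc zero) zero = symm Ava
    p-adj (suc zero) (suc zero) = adj-irrefl B _
    p-adj (suc zero) (suc (suc zero)) = Aac
    p-adj (suc zero) (suc (suc (suc zero))) = symm Awa
    p-adj (suc zero) (suc (suc (suc (suc zero)))) = Aab
    p-adj (suc (suc zero)) zero = symm Avc
    p-adj (suc (suc zero)) (suc zero) = symm Aac
    p-adj (suc (suc zero)) (suc (suc zero)) = adj-irrefl B _
    p-adj (suc (suc zero)) (suc (suc (suc zero))) = symm Awc
    p-adj (suc (suc zero)) (suc (suc (suc (suc zero)))) = symm Abc
    p-adj (suc (suc (suc zero))) zero = symm Avw
    p-adj (suc (suc (suc zero))) (suc zero) = Awa
    p-adj (suc (suc (suc zero))) (suc (suc zero)) = Awc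
    p-adj (suc (suc (suc zero))) (suc (suc (suc zero))) = adj-irrefl B _
    p-adj (suc (suc (suc zero))) (suc (suc (suc (suc zero)))) = Awb
    p-adj (suc (suc (suc (suc zero)))) zero = symm Avb
    p-adj (suc (suc (suc (suc zero)))) (suc zero) = symm Aab
    p-adj (suc (suc (suc (suc zero)))) (suc (suc zero)) = Abc
    p-adj (suc (suc (suc (suc zero)))) (suc (suc (suc zero))) = symm Awb
    p-adj (suc (suc (suc (suc zero)))) (suc (suc (suc (suc zero)))) = adj-irrefl B _

    C5 : Adjacency 5
    C5 = adj (cycle 5)

    -- For the injectivity of `p`: equal vertices of `B` have equal rows, and `p-adj` carries these
    -- over to the pentagon.
    distinct-rows : ∀ s t → s ≢ t → ∃[ u ] C5 s u ≢ C5 t u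
    distinct-rows = from-yes (Fin.all? (λ s → Fin.all? (λ t → ¬? (s ≟ t) →-dec
      Fin.any? (λ u → ¬? (C5 s u Bool.≟ C5 t u)))))

    injective : ∀ {s t} → p s ≡ p t → s ≡ t
    injective {s} {t} eq with s ≟ t
    ... | yes s≡t = s≡t
    ... | no  s≢t with distinct-rows s t s≢t
    ...   | u , differ = contradiction (trans (sym (p-adj s u)) (trans (cong (λ x → A x (p u)) eq) (p-adj t u))) differ

  pentagon : B ≅ cycle 5
  pentagon = isomorphism B (cycle 5) p injective surjective p-adj

-- Complete multipartite graphs

module Multipartite {N} (B : Graph (Fin N))
  (cotransitive : ∀ a b c → adj B a b ≡ false → adj B b c ≡ false → adj B a c ≡ false) where

  private
    A = adj B
    A-sym = adj-sym B

  part : Fin N → Fin N → Bool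
  part v u = not (A v u)

  size : Fin N → ℕ
  size v = count (part v)

  nonadjacent : ∀ {u v} → part u v ≡ true → A u v ≡ false
  nonadjacent = Bool.not-injective

  across : ∀ {v x y} → A v x ≡ false → A v y ≡ true → A x y ≡ true
  across Avx Avy = Bool.¬-not λ Axy → false≢true (cotransitive _ _ _ Avx Axy) Avy

  self : ∀ v → part v v ≡ true
  self v = cong not (adj-irrefl B v)

  completeGraph : (∀ u v → u ≢ v → A u v ≡ true) → B ≅ complete N
  completeGraph edge = isomorphism B (complete N) id id (λ v → v , refl) λ u v → adjacent u v
    where
    adjacent : ∀ u v → A u v ≡ not (δ u v)
    adjacent u v with u ≟ v
    ... | yes refl = adj-irrefl B u
    ... | no  u≢v  = edge u v u≢v

  -- The edge from `k` to `l` is the spine, and all other vertices form the part of `v`. That part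
  -- contains `u` and `w`, whence two pages: if either were adjacent to `v`, then so would be the
  -- other, and two distinct neighbours of `v` are `k` and `l`, which are adjacent.
  book : ∀ {k l v u w} → A k l ≡ true → Apex B k l v → u ≢ w → A u w ≡ false →
    ∃[ m ] (2 ≤ m × B ≅ complete 2 ⋈ edgeless m)
  book {k} {l} {v} {u} {w} Akl apex@(Avk , Avl , others) u≢w Auw = size v ,
    two-members (enumerate (part v)) (cong not (page u w u≢w Auw)) (cong not (page w u (u≢w ∘ sym) (trans (A-sym w u) Auw))) u≢w ,
    isomorphism B (complete 2 ⋈ edgeless (size v)) p injective surjective p-adj
    where
    open Enumeration (enumerate (part v))
    page : ∀ u w → u ≢ w → A u w ≡ false → A v u ≡ false
    page u w u≢w Auw = Bool.¬-not λ Avu → absurd Avu (across′ Avu)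
      where
      across′ : A v u ≡ true → A v w ≡ true
      across′ Avu = trans (A-sym v w) (across Auw (trans (A-sym u v) Avu))
      absurd : A v u ≡ true → A v w ≡ true → ⊥
      absurd Avu Avw with neighbour-of-apex B apex Avu | neighbour-of-apex B apex Avw
      ... | inj₁ refl | inj₁ refl = u≢w refl
      ... | inj₁ refl | inj₂ refl = false≢true Auw Akl
      ... | inj₂ refl | inj₁ refl = false≢true Auw (trans (A-sym l k) Akl)
      ... | inj₂ refl | inj₂ refl = u≢w refl
    p : Fin 2 ⊎ Fin (size v) → Fin N
    p (inj₁ zero)       = k
    p (inj₁ (suc zero)) = l
    p (inj₂ t)          = elt t
    Av-elt : ∀ t → A v (elt t) ≡ false
    Av-elt t = nonadjacent (sound t)
    p-adj : ∀ s t → A (p s) (p t) ≡ adj (complete 2 ⋈ edgeless (size v)) s t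
    p-adj (inj₁ zero)       (inj₁ zero)       = adj-irrefl B k
    p-adj (inj₁ zero)       (inj₁ (suc zero)) = Akl
    p-adj (inj₁ (suc zero)) (inj₁ zero)       = trans (A-sym l k) Akl
    p-adj (inj₁ (suc zero)) (inj₁ (suc zero)) = adj-irrefl B l
    p-adj (inj₁ zero)       (inj₂ t)          = trans (A-sym k (elt t)) (across (Av-elt t) Avk)
    p-adj (inj₁ (suc zero)) (inj₂ t)          = trans (A-sym l (elt t)) (across (Av-elt t) Avl)
    p-adj (inj₂ s)          (inj₁ zero)       = across (Av-elt s) Avk
    p-adj (inj₂ s)          (inj₁ (suc zero)) = across (Av-elt s) Avl
    p-adj (inj₂ s)          (inj₂ t)          = cotransitive _ v _ (trans (A-sym _ v) (Av-elt s)) (Av-elt t)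
    injective : ∀ {s t} → p s ≡ p t → s ≡ t
    injective {inj₁ zero}       {inj₁ zero}       _  = refl
    injective {inj₁ zero}       {inj₁ (suc zero)} eq = contradiction eq (adjacent⇒distinct B Akl)
    injective {inj₁ (suc zero)} {inj₁ zero}       eq = contradiction (sym eq) (adjacent⇒distinct B Akl)
    injective {inj₁ (suc zero)} {inj₁ (suc zero)} _  = refl
    injective {inj₁ zero}       {inj₂ t}          eq = ⊥-elim (false≢true (Av-elt t) (trans (cong (A v) (sym eq)) Avk))
    injective {inj₁ (suc zero)} {inj₂ t}          eq = ⊥-elim (false≢true (Av-elt t) (trans (cong (A v) (sym eq)) Avl))
    injective {inj₂ s}          {inj₁ zero}       eq = ⊥-elim (false≢true (Av-elt s) (trans (cong (A v) eq) Avk))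
    injective {inj₂ s}          {inj₁ (suc zero)} eq = ⊥-elim (false≢true (Av-elt s) (trans (cong (A v) eq) Avl))
    injective {inj₂ s}          {inj₂ t}          eq = cong inj₂ (elt-injective eq)
    surjective : ∀ y → ∃[ s ] p s ≡ y
    surjective y with y ≟ k | y ≟ l
    ... | yes refl | _        = inj₁ zero , refl
    ... | no _     | yes refl = inj₁ (suc zero) , refl
    ... | no y≢k   | no y≢l   with complete-elt y (cong not (others y y≢k y≢l))
    ...   | t , eq = inj₂ t , eq

  -- By the second hypothesis no vertex is adjacent to both `i` and `j`, so their two parts exhaust
  -- the graph.
  bipartite : ∀ {i j} → A i j ≡ true → (∀ h → A i h ≡ false ⊎ A j h ≡ false) →
    B ≅ edgeless (size i) ⋈ edgeless (size j)
  bipartite {i} {j} Aij side = isomorphism B (edgeless (size i) ⋈ edgeless (size j)) p injective surjective p-adj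
    where
    module I = Enumeration (enumerate (part i))
    module J = Enumeration (enumerate (part j))
    p : Fin (size i) ⊎ Fin (size j) → Fin N
    p (inj₁ s) = I.elt s
    p (inj₂ t) = J.elt t
    AI : ∀ s → A i (I.elt s) ≡ false
    AI s = nonadjacent (I.sound s)
    AJ : ∀ t → A j (J.elt t) ≡ false
    AJ t = nonadjacent (J.sound t)
    AIJ : ∀ s t → A (I.elt s) (J.elt t) ≡ true
    AIJ s t = across (AI s) (trans (A-sym i _) (across (AJ t) (trans (A-sym j i) Aij)))
    p-adj : ∀ s t → A (p s) (p t) ≡ adj (edgeless (size i) ⋈ edgeless (size j)) s t
    p-adj (inj₁ s) (inj₁ t) = cotransitive _ i _ (trans (A-sym _ i) (AI s)) (AI t)
    p-adj (inj₁ s) (inj₂ t) = AIJ s t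
    p-adj (inj₂ s) (inj₁ t) = trans (A-sym _ _) (AIJ t s)
    p-adj (inj₂ s) (inj₂ t) = cotransitive _ j _ (trans (A-sym _ j) (AJ s)) (AJ t)
    injective : ∀ {s t} → p s ≡ p t → s ≡ t
    injective {inj₁ s} {inj₁ t} eq = cong inj₁ (I.elt-injective eq)
    injective {inj₁ s} {inj₂ t} eq = contradiction eq (adjacent⇒distinct B (AIJ s t))
    injective {inj₂ s} {inj₁ t} eq = contradiction (sym eq) (adjacent⇒distinct B (AIJ t s))
    injective {inj₂ s} {inj₂ t} eq = cong inj₂ (J.elt-injective eq)
    surjective : ∀ y → ∃[ s ] p s ≡ y
    surjective y with side y
    ... | inj₁ Aiy = inj₁ (proj₁ (I.complete-elt y (cong not Aiy))) , proj₂ (I.complete-elt y (cong not Aiy))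
    ... | inj₂ Ajy = inj₂ (proj₁ (J.complete-elt y (cong not Ajy))) , proj₂ (J.complete-elt y (cong not Ajy))

  unbalanced : ∀ {i j} → A i j ≡ true → (∀ h → A i h ≡ false ⊎ A j h ≡ false) → size i < size j →
    ∃[ k ] ∃[ m ] (1 ≤ k × k < m × B ≅ edgeless k ⋈ edgeless m)
  unbalanced {i} {j} Aij side i<j = size i , size j ,
    nonempty (proj₁ (Enumeration.complete-elt (enumerate (part i)) i (self i))) , i<j , bipartite Aij side

  balanced : ∀ {k i j u w} → (∀ v → size v ≡ k) → A i j ≡ true → u ≢ w → A u w ≡ false →
    ∃[ r ] ∃[ k ] (2 ≤ r × 2 ≤ k × B ≅ joinOfCopies r (edgeless k))
  balanced {k} {u = u} sizes Aij u≢w Auw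
    with cells part self (λ u v → cong not (A-sym u v))
      (λ x y z Pxy Pyz → cong not (cotransitive x y z (nonadjacent Pxy) (nonadjacent Pyz)))
      (λ v → subst (Enumeration (part v)) (sizes v) (enumerate (part v)))
  ... | r , C = r , k , two-cells C (cong not Aij) ,
    subst (2 ≤_) (sizes u) (two-members (enumerate (part u)) (self u) (cong not Auw) u≢w) ,
    isomorphism B (joinOfCopies r (edgeless k)) (cell ∘ split r) (split-injective r ∘ cell-injective)
      (λ v → place r (proj₁ (cell-surjective v)) , trans (cong cell (split-place r _)) (proj₂ (cell-surjective v)))
      (λ c d → trans (adj-cell (split r c) (split r d)) (sym (adj-joinOfCopies (edgeless k) r c d)))
    where
    open Cells C
    adj-cell : ∀ s t → A (cell s) (cell t) ≡ (if δ (proj₁ s) (proj₁ t) then false else true)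
    adj-cell s t = Bool.not-injective (trans (R-cell s t) (if-not (δ (proj₁ s) (proj₁ t))))
      where
      if-not : ∀ b → b ≡ not (if b then false else true)
      if-not true  = refl
      if-not false = refl

  -- An edge distinguishes exactly the vertices in the parts of its two ends, and these parts are
  -- disjoint.
  size-sum : ∀ {k l} → A k l ≡ true → sum (λ v → indicator (A k v xor A l v)) ≡ size k + size l
  size-sum {k} {l} Akl = trans (sum-cong-≗ pointwise) (∑-distrib-+ (indicator ∘ part k) (indicator ∘ part l))
    where
    pointwise : ∀ v → indicator (A k v xor A l v) ≡ indicator (part k v) + indicator (part l v)
    pointwise v with A k v in Akv | A l v in Alv
    ... | true  | true  = refl
    ... | true  | false = refl
    ... | false | true  = refl
    ... | false | false = contradiction Akl (false≢true (cotransitive k v l Akv (trans (A-sym v l) Alv)))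

-- Case distinction on the dominating pair

module Necessity {N} (B : Graph (Fin N)) {q : Point N → Bool} (Q : Quadratic (adj B) q)
  (neighbour : ∀ v → ∃[ u ] adj B v u ≡ true) {i j : Fin N} (i≢j : i ≢ j)
  (dominates : ∀ k l → k ≢ l → Dominates q i j k l) where

  private
    A = adj B
    A-sym = adj-sym B

    compare : ∀ k l (k≢l : k ≢ l) {C : Set} →
      ((¬apex : ∀ v → ¬ Apex B k l v) → ¬ FalseTwins B k l → C) → (∃[ v ] Apex B k l v) ⊎ FalseTwins B k l ⊎ C
    compare k l k≢l f with Fin.any? (Apex? B k l) | Fin.all? (λ w → A k w Bool.≟ A l w)
    ... | yes p | _     = inj₁ p
    ... | no _  | yes t = inj₂ (inj₁ t)
    ... | no ¬p | no ¬t = inj₂ (inj₂ (f (λ v a → ¬p (v , a)) ¬t))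

    adjacent-compare : ∀ k l {C : Set} → A k l ≡ true →
      (k ≢ l → (∀ v → ¬ Apex B k l v) → ¬ FalseTwins B k l → C) → (∃[ v ] Apex B k l v) ⊎ C
    adjacent-compare k l Akl f with compare k l (adjacent⇒distinct B Akl) (f (adjacent⇒distinct B Akl))
    ... | inj₁ p             = inj₁ p
    ... | inj₂ (inj₁ twins)  = contradiction (trans (sym (twins l)) Akl) (false≢true (adj-irrefl B l))
    ... | inj₂ (inj₂ c)      = inj₂ c

    edge-apex : A i j ≡ false → ∀ k l → A k l ≡ true → ∃[ v ] Apex B k l v
    edge-apex Aij k l Akl with adjacent-compare k l Akl
      (λ k≢l ¬a ¬t → Comparison.same-adjacency B Q neighbour i≢j k≢l (dominates k l k≢l) ¬a ¬t)
    ... | inj₁ p  = p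
    ... | inj₂ eq = contradiction (trans (sym eq) Akl) (false≢true Aij)

    module _ (Aij : A i j ≡ true) where

      nonedge : ∀ k l → k ≢ l → A k l ≡ false → (∃[ v ] Apex B k l v) ⊎ FalseTwins B k l
      nonedge k l k≢l Akl with compare k l k≢l
        (λ ¬a ¬t → Comparison.same-adjacency B Q neighbour i≢j k≢l (dominates k l k≢l) ¬a ¬t)
      ... | inj₁ p          = inj₁ p
      ... | inj₂ (inj₁ t)   = inj₂ t
      ... | inj₂ (inj₂ eq)  = contradiction Akl λ Akl → false≢true Akl (trans eq Aij)

      module _ (cotransitive : ∀ a b c → A a b ≡ false → A b c ≡ false → A a c ≡ false) where

        open Multipartite B cotransitive

        -- Reindexing by the permutation `ρ` equates the numbers of vertices distinguished by the
        -- two edges, and `size-sum` turns them into sums of part sizes.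
        edge-size : ∀ k l → A k l ≡ true → (∀ v → ¬ Apex B k l v) → size k + size l ≡ size i + size j
        edge-size k l Akl ¬apex =
          [ (λ (v , apex) → contradiction apex (¬apex v)) , id ]′ (adjacent-compare k l Akl counts)
          where
          counts : k ≢ l → (∀ v → ¬ Apex B k l v) → ¬ FalseTwins B k l → size k + size l ≡ size i + size j
          counts k≢l ¬a ¬t = begin
            size k + size l                                   ≡⟨ size-sum Akl ⟨
            sum (λ v → indicator (A k v xor A l v))           ≡⟨ sum-cong-≗ (λ v → cong indicator (same-distinguished Akl v)) ⟩
            sum (λ v → indicator (A i (ρ v) xor A j (ρ v)))   ≡⟨ sum-permute ends (mk↔ₛ′ ρ π ρ-π π-ρ) ⟨
            sum ends                                          ≡⟨ size-sum Aij ⟩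
            size i + size j                                   ∎
            where
            open ≡-Reasoning
            open Comparison B Q neighbour i≢j k≢l (dominates k l k≢l) ¬a ¬t
            ends : Fin N → ℕ
            ends v = indicator (A i v xor A j v)

        multipartite : Family B
        multipartite with Fin.any? (λ u → Fin.any? (λ w → ¬? (u ≟ w) ×-dec (A u w Bool.≟ false)))
        ... | no ¬p = inj₂ (inj₂ (inj₂ (inj₁ (N , two-elements i≢j ,
                completeGraph λ u w u≢w → Bool.¬-not λ Auw → ¬p (u , w , u≢w , Auw)))))
        ... | yes (u , w , u≢w , Auw)
            with Fin.any? (λ k → Fin.any? (λ l → Fin.any? (λ v → (A k l Bool.≟ true) ×-dec Apex? B k l v)))
        ...   | yes (k , l , v , Akl , apex) = inj₂ (inj₂ (inj₁ (book Akl apex u≢w Auw)))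
        ...   | no ¬a with Fin.all? (λ v → size v ℕ.≟ size i)
        ...     | yes sizes = inj₂ (inj₂ (inj₂ (inj₂ (inj₂ (balanced sizes Aij u≢w Auw)))))
        ...     | no ¬sizes = inj₂ (inj₂ (inj₂ (inj₂ (inj₁ (compare-sizes (ℕ.<-cmp (size i) (size j)))))))
          where
          sum-of : ∀ k l → A k l ≡ true → size k + size l ≡ size i + size j
          sum-of k l Akl = edge-size k l Akl λ v apex → ¬a (k , l , v , Akl , apex)
          beside-i : ∀ {v} → A i v ≡ true → size v ≡ size j
          beside-i {v} Aiv = ℕ.+-cancelˡ-≡ (size i) (size v) (size j) (sum-of i v Aiv)
          beside-j : ∀ {v} → A j v ≡ true → size v ≡ size i
          beside-j {v} Ajv = ℕ.+-cancelˡ-≡ (size j) (size v) (size i) (trans (sum-of j v Ajv) (ℕ.+-comm (size i) (size j)))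
          -- If the two sizes were equal, all parts would have that size: a vertex outside the part
          -- of `i` is adjacent to `i`, and one inside it is adjacent to `j`.
          unequal : size i ≢ size j
          unequal eq = ¬sizes sizes
            where
            sizes : ∀ v → size v ≡ size i
            sizes v with A i v in Aiv
            ... | true  = trans (beside-i Aiv) (sym eq)
            ... | false = beside-j (trans (A-sym j v) (across Aiv Aij))
          -- The part of a common neighbour of `i` and `j` would have both `size j` and `size i`
          -- elements.
          side : ∀ h → A i h ≡ false ⊎ A j h ≡ false
          side h with A i h in Aih | A j h in Ajh
          ... | false | _     = inj₁ refl
          ... | true  | false = inj₂ refl
          ... | true  | true  = contradiction (trans (sym (beside-j Ajh)) (beside-i Aih)) unequal
          swap : ∀ h → A j h ≡ false ⊎ A i h ≡ false
          swap h = [ inj₂ , inj₁ ]′ (side h)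
          compare-sizes : Tri (size i < size j) (size i ≡ size j) (size j < size i) →
            ∃[ k ] ∃[ m ] (1 ≤ k × k < m × B ≅ edgeless k ⋈ edgeless m)
          compare-sizes (tri< i<j _ _) = unbalanced Aij side i<j
          compare-sizes (tri≈ _ eq _)  = contradiction eq unequal
          compare-sizes (tri> _ _ j<i) = unbalanced (trans (A-sym j i) Aij) swap j<i

  family : Family B
  family with A i j in Aij
  ... | false = inj₁ (Triangles.union-of-triangles B neighbour (edge-apex Aij) i≢j Aij)
  ... | true with Fin.any? (λ a → Fin.any? (λ b → Fin.any? (λ c →
          (A a b Bool.≟ false) ×-dec ((A b c Bool.≟ false) ×-dec (A a c Bool.≟ true)))))
  ...   | yes (a , b , c , Aab , Abc , Aac) = inj₂ (inj₁ (Pentagon.pentagon B (nonedge Aij) Aab Abc Aac))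
  ...   | no ¬p = multipartite Aij λ a b c Aab Abc → Bool.¬-not λ Aac → ¬p (a , b , c , Aab , Abc , Aac)

-- Sufficiency

transpose-matchˡ : ∀ {n} (i j : Fin n) → transpose i j i ≡ j
transpose-matchˡ i j rewrite δ-refl i = refl

transpose-off : ∀ {n} {i j k : Fin n} → k ≢ i → k ≢ j → transpose i j k ≡ k
transpose-off k≢i k≢j rewrite δ-≢ k≢i | δ-≢ k≢j = refl

transpose-surjective : ∀ {n} (i j k : Fin n) → ∃[ l ] transpose i j l ≡ k
transpose-surjective i j k = transpose j i k , transpose-inverse i j

transpose-injective : ∀ {n} (i j : Fin n) {k l} → transpose i j k ≡ transpose i j l → k ≡ l
transpose-injective i j = surjective⇒injective (transpose i j) (transpose-surjective i j)

module Sufficiency {N} (B : Graph (Fin N)) {q : Point N → Bool} (Q : Quadratic (adj B) q) where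

  open Moves B Q

  module Labelled {W : Set} (h : W → W → Bool) (p : W → Fin N) (p-injective : ∀ {s t} → p s ≡ p t → s ≡ t)
    (p-surjective : ∀ v → ∃[ s ] p s ≡ v) (p-adj : ∀ s t → A (p s) (p t) ≡ h s t) where

    infix 4 _⊵_

    _⊵_ : W × W → W × W → Set
    (s , t) ⊵ (s′ , t′) = (p s , p t) ⊒ (p s′ , p t′)

    greatest : ∀ {s₀ t₀} → s₀ ≢ t₀ → (∀ s t → s ≢ t → (s₀ , t₀) ⊵ (s , t)) → Greatest q
    greatest {s₀} {t₀} s₀≢t₀ dominates = p s₀ , p t₀ , s₀≢t₀ ∘ p-injective , λ k l k≢l → go k l k≢l
      where
      go : ∀ k l → k ≢ l → (p s₀ , p t₀) ⊒ (k , l)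
      go k l k≢l with p-surjective k | p-surjective l
      ... | s , refl | t , refl = dominates s t (k≢l ∘ cong p)

    apex-⊵ : ∀ {s t v} → s ≢ t → h v s ≡ true → h v t ≡ true → (∀ w → w ≢ s → w ≢ t → h v w ≡ false) →
      ∀ x → (v , x) ⊵ (s , t)
    apex-⊵ {s} {t} {v} s≢t hvs hvt others x =
      apex-⊒ (s≢t ∘ p-injective) (trans (p-adj v s) hvs , trans (p-adj v t) hvt , others′) (p x)
      where
      others′ : ∀ w → w ≢ p s → w ≢ p t → A (p v) w ≡ false
      others′ w w≢s w≢t with p-surjective w
      ... | w′ , refl = trans (p-adj v w′) (others w′ (w≢s ∘ cong p) (w≢t ∘ cong p))

    falseTwins-⊵ : ∀ {s t} → s ≢ t → (∀ w → h s w ≡ h t w) → ∀ x → (s , x) ⊵ (s , t)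
    falseTwins-⊵ {s} {t} s≢t same x = falseTwins-⊒ (s≢t ∘ p-injective) same′ (p x)
      where
      same′ : FalseTwins B (p s) (p t)
      same′ w with p-surjective w
      ... | w′ , refl = trans (p-adj s w′) (trans (same w′) (sym (p-adj t w′)))

    twins-⊵ : ∀ {s t x} → s ≢ t → x ≢ s → x ≢ t → (∀ w → w ≢ s → w ≢ t → h s w ≡ h t w) → (s , x) ⊵ (t , x)
    twins-⊵ {s} {t} s≢t x≢s x≢t same =
      twins-⊒ (s≢t ∘ p-injective) (x≢s ∘ p-injective) (x≢t ∘ p-injective) same′
      where
      same′ : Twins B (p s) (p t)
      same′ w w≢s w≢t with p-surjective w
      ... | w′ , refl = trans (p-adj s w′) (trans (same w′ (w≢s ∘ cong p) (w≢t ∘ cong p)) (sym (p-adj t w′)))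

    automorphism-⊵ : (α : W → W) → (∀ s → ∃[ t ] α t ≡ s) → (∀ s t → h (α s) (α t) ≡ h s t) →
      ∀ {s t} → (s , t) ⊵ (α s , α t)
    automorphism-⊵ α surj α-adj {s} {t} =
      subst₂ (λ x y → (p s , p t) ⊒ (x , y)) (π-p s) (π-p t) (automorphism-⊒ π π-surj π-adj)
      where
      label : Fin N → W
      label v = proj₁ (p-surjective v)
      p-label : ∀ v → p (label v) ≡ v
      p-label v = proj₂ (p-surjective v)
      π : Fin N → Fin N
      π v = p (α (label v))
      π-p : ∀ s → π (p s) ≡ p (α s)
      π-p s = cong (p ∘ α) (p-injective (p-label (p s)))
      π-surj : ∀ v → ∃[ t ] π t ≡ v
      π-surj v with surj (label v)
      ... | t , αt≡ = p t , trans (π-p t) (trans (cong p αt≡) (p-label v))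
      π-adj : ∀ u v → A (π u) (π v) ≡ A u v
      π-adj u v = trans (p-adj _ _) (trans (α-adj _ _) (trans (sym (p-adj _ _)) (cong₂ A (p-label u) (p-label v))))

  -- For b = false the disjoint union of r copies of g, and for b = true their join.
  blockAdj : ∀ {r k} → (Fin k → Fin k → Bool) → Bool → Fin r × Fin k → Fin r × Fin k → Bool
  blockAdj g b (a , x) (c , y) = if δ a c then g x y else b

  module Blocks {r k} (g : Fin k → Fin k → Bool) (b : Bool) (g-twins : ∀ x y z → z ≢ x → z ≢ y → g x z ≡ g y z)
    (p : Fin r × Fin k → Fin N) (p-injective : ∀ {s t} → p s ≡ p t → s ≡ t)
    (p-surjective : ∀ v → ∃[ s ] p s ≡ v) (p-adj : ∀ s t → A (p s) (p t) ≡ blockAdj g b s t) where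

    open Labelled (blockAdj g b) p p-injective p-surjective p-adj public

    private
      -- By `g-twins` two vertices of a block are twins, since other blocks do not tell them apart.
      within : ∀ {a c x y} z → a ≢ c → ((a , x) , (c , y)) ⊵ ((a , z) , (c , y))
      within {a} {c} {x} {y} z a≢c with x ≟ z
      ... | yes refl = ⊒-refl
      ... | no  x≢z  = twins-⊵ (x≢z ∘ cong proj₂) (a≢c ∘ sym ∘ cong proj₁) (a≢c ∘ sym ∘ cong proj₁) same
        where
        same : ∀ w → w ≢ (a , x) → w ≢ (a , z) → blockAdj g b (a , x) w ≡ blockAdj g b (a , z) w
        same (d , u) w≢x w≢z with a ≟ d
        ... | yes refl = g-twins x z u (w≢x ∘ cong (a ,_)) (w≢z ∘ cong (a ,_))
        ... | no  _    = refl

      -- Interchanging the blocks `a` and `d` is an automorphism that fixes the block `c`.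
      shift : ∀ {a c x y} d → a ≢ c → d ≢ c → ((a , x) , (c , y)) ⊵ ((d , x) , (c , y))
      shift {a} {c} {x} {y} d a≢c d≢c = subst₂ (λ s t → ((a , x) , (c , y)) ⊵ ((s , x) , (t , y)))
        (transpose-matchˡ a d) (transpose-off (a≢c ∘ sym) (d≢c ∘ sym))
        (automorphism-⊵ α (λ (e , t) → (proj₁ (transpose-surjective a d e) , t) , cong (_, t) (proj₂ (transpose-surjective a d e))) α-adj)
        where
        α : Fin r × Fin k → Fin r × Fin k
        α (e , t) = transpose a d e , t
        α-adj : ∀ s t → blockAdj g b (α s) (α t) ≡ blockAdj g b s t
        α-adj (e , t) (f , u) = cong (λ z → if z then g t u else b) (both-true
          (λ eq → δ-≡ {u = e} {f} (transpose-injective a d (δ-true eq)))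
          (λ eq → δ-≡ {u = transpose a d e} (cong (transpose a d) (δ-true {u = e} eq))))

      across : ∀ {a c x y} d e z w → a ≢ c → d ≢ e → d ≢ c → ((a , x) , (c , y)) ⊵ ((d , z) , (e , w))
      across d e z w a≢c d≢e d≢c =
        ⊒-trans (shift d a≢c d≢c) (⊒-trans (within z d≢c) (⊒-trans ⊒-swap
        (⊒-trans (shift e (d≢c ∘ sym) (d≢e ∘ sym)) (⊒-trans (within w (d≢e ∘ sym)) ⊒-swap))))

    -- Move one end at a time by `shift` and `within`. The intermediate pairs must lie in two
    -- different blocks, so the ends are swapped first when the target block `d` is `c`.
    between : ∀ {a c x y} d e z w → a ≢ c → d ≢ e → ((a , x) , (c , y)) ⊵ ((d , z) , (e , w))
    between {a} {c} d e z w a≢c d≢e with d ≟ c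
    ... | no  d≢c  = across d e z w a≢c d≢e d≢c
    ... | yes refl = ⊒-trans ⊒-swap (across d e z w (a≢c ∘ sym) d≢e (a≢c ∘ sym))

    greatest-between : ∀ {a c : Fin r} → a ≢ c → Fin k →
      (∀ d x z → x ≢ z → ∃[ v ] (∀ w → ((d , v) , w) ⊵ ((d , x) , (d , z)))) → Greatest q
    greatest-between {a} {c} a≢c o inside = greatest {a , o} {c , o} (a≢c ∘ cong proj₁) dominates
      where
      dominates : ∀ s t → s ≢ t → ((a , o) , (c , o)) ⊵ (s , t)
      dominates (d , x) (e , z) s≢t with d ≟ e
      ... | no  d≢e  = between d e x z a≢c d≢e
      ... | yes refl with inside d x z (s≢t ∘ cong (d ,_)) | d ≟ a
      -- The partner of `v` is taken from a block other than `d`, so that `between` applies.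
      ...   | v , inside-v | yes refl = ⊒-trans (between d c v o a≢c a≢c) (inside-v (c , o))
      ...   | v , inside-v | no  d≢a  = ⊒-trans (between d a v o a≢c d≢a) (inside-v (a , o))

  module Join {k m} (g : Fin k → Fin k → Bool) (g-twins : ∀ x y z → z ≢ x → z ≢ y → g x z ≡ g y z)
    (h : Fin k ⊎ Fin m → Fin k ⊎ Fin m → Bool)
    (h₁₁ : ∀ x y → h (inj₁ x) (inj₁ y) ≡ g x y) (h₁₂ : ∀ x y → h (inj₁ x) (inj₂ y) ≡ true)
    (h₂₁ : ∀ x y → h (inj₂ x) (inj₁ y) ≡ true) (h₂₂ : ∀ x y → h (inj₂ x) (inj₂ y) ≡ false)
    (p : Fin k ⊎ Fin m → Fin N) (p-injective : ∀ {s t} → p s ≡ p t → s ≡ t)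
    (p-surjective : ∀ v → ∃[ s ] p s ≡ v) (p-adj : ∀ s t → A (p s) (p t) ≡ h s t) where

    open Labelled h p p-injective p-surjective p-adj public

    private
      same₂ : ∀ y w u → h (inj₂ y) u ≡ h (inj₂ w) u
      same₂ y w (inj₁ u) = trans (h₂₁ y u) (sym (h₂₁ w u))
      same₂ y w (inj₂ u) = trans (h₂₂ y u) (sym (h₂₂ w u))

      move₁ : ∀ {x y} z → (inj₁ x , inj₂ y) ⊵ (inj₁ z , inj₂ y)
      move₁ {x} {y} z with x ≟ z
      ... | yes refl = ⊒-refl
      ... | no  x≢z  = twins-⊵ (λ { refl → x≢z refl }) (λ ()) (λ ()) same
        where
        same : ∀ w → w ≢ inj₁ x → w ≢ inj₁ z → h (inj₁ x) w ≡ h (inj₁ z) w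
        same (inj₁ w) w≢x w≢z = trans (h₁₁ x w) (trans (g-twins x z w (w≢x ∘ cong inj₁) (w≢z ∘ cong inj₁)) (sym (h₁₁ z w)))
        same (inj₂ w) _   _   = trans (h₁₂ x w) (sym (h₁₂ z w))

      move₂ : ∀ {x y} w → (inj₁ x , inj₂ y) ⊵ (inj₁ x , inj₂ w)
      move₂ {x} {y} w with y ≟ w
      ... | yes refl = ⊒-refl
      ... | no  y≢w  = ⊒-trans ⊒-swap (⊒-trans
              (twins-⊵ (λ { refl → y≢w refl }) (λ ()) (λ ()) (λ u _ _ → same₂ y w u)) ⊒-swap)

      cross : ∀ {x y} z w → (inj₁ x , inj₂ y) ⊵ (inj₁ z , inj₂ w)
      cross z w = ⊒-trans (move₁ z) (move₂ w)

    -- Cross pairs dominate each other, since each side consists of twins. Pairs on the edgeless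
    -- side are false twins; those on the other side are left to the last hypothesis.
    greatest-cross : Fin k → Fin m →
      (∀ x z → x ≢ z → ∃[ v ] ∃[ w ] (inj₁ v , inj₂ w) ⊵ (inj₁ x , inj₁ z)) → Greatest q
    greatest-cross x₀ y₀ inside = greatest {inj₁ x₀} {inj₂ y₀} (λ ()) dominates
      where
      dominates : ∀ s t → s ≢ t → (inj₁ x₀ , inj₂ y₀) ⊵ (s , t)
      dominates (inj₁ x) (inj₂ y) _ = cross x y
      dominates (inj₂ y) (inj₁ x) _ = ⊒-trans (cross x y) ⊒-swap
      dominates (inj₂ y) (inj₂ w) s≢t = ⊒-trans (cross x₀ y) (⊒-trans ⊒-swap
        (falseTwins-⊵ s≢t (same₂ y w) (inj₁ x₀)))
      dominates (inj₁ x) (inj₁ z) s≢t with inside x z (s≢t ∘ cong inj₁)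
      ... | v , w , inside-vw = ⊒-trans (cross v w) inside-vw

  -- Greatest pairs in the six families

  module FromIso {W : Set} (H : Graph W) (iso : B ≅ H) where

    open Inverse (proj₁ iso) public using (to; from; strictlyInverseˡ; strictlyInverseʳ)

    from-injective : ∀ {s t} → from s ≡ from t → s ≡ t
    from-injective {s} {t} eq = trans (sym (strictlyInverseˡ s)) (trans (cong to eq) (strictlyInverseˡ t))

    from-surjective : ∀ v → ∃[ s ] from s ≡ v
    from-surjective v = to v , strictlyInverseʳ v

    from-adj : ∀ s t → A (from s) (from t) ≡ adj H s t
    from-adj s t = trans (sym (proj₂ iso (from s) (from t))) (cong₂ (adj H) (strictlyInverseˡ s) (strictlyInverseˡ t))

  complete-twins : ∀ {k} (x y z : Fin k) → z ≢ x → z ≢ y → not (δ x z) ≡ not (δ y z)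
  complete-twins x y z z≢x z≢y = cong not (trans (δ-≢ (z≢x ∘ sym)) (sym (δ-≢ (z≢y ∘ sym))))

  two : ∀ {k} → 2 ≤ k → Σ[ a ∈ Fin k ] ∃[ c ] a ≢ c
  two (s≤s (s≤s _)) = zero , suc zero , λ ()

  one : ∀ {k} → 1 ≤ k → Fin k
  one (s≤s _) = zero

  third : (x z : Fin 3) → x ≢ z → ∃[ v ] (v ≢ x × v ≢ z × (∀ w → w ≢ x → w ≢ z → w ≡ v))
  third = from-yes (Fin.all? λ (x : Fin 3) → Fin.all? λ z → ¬? (x ≟ z) →-dec Fin.any? λ v → ¬? (v ≟ x) ×-dec (¬? (v ≟ z) ×-dec
    Fin.all? λ w → ¬? (w ≟ x) →-dec (¬? (w ≟ z) →-dec (w ≟ v))))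

  module _ {V : Set} (r : ℕ) (p : Copies r V → Fin N) where

    place-injective : (∀ {c d} → p c ≡ p d → c ≡ d) → ∀ {s t} → p (place r s) ≡ p (place r t) → s ≡ t
    place-injective injective {s} {t} eq =
      trans (sym (split-place r s)) (trans (cong (split r) (injective eq)) (split-place r t))

    place-surjective : (∀ v → ∃[ c ] p c ≡ v) → ∀ v → ∃[ s ] p (place r s) ≡ v
    place-surjective surjective v =
      split r (proj₁ (surjective v)) , trans (cong p (place-split r _)) (proj₂ (surjective v))

  -- The blocks are the triangles; in each, the third vertex is an apex of the other two.
  trianglesGreatest : ∀ r → 2 ≤ r → B ≅ unionOfCopies r (complete 3) → Greatest q
  trianglesGreatest r 2≤r iso = greatest-between (proj₂ (proj₂ (two 2≤r))) zero inside
    where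
    open FromIso (unionOfCopies r (complete 3)) iso
    open Blocks (adj (complete 3)) false complete-twins (from ∘ place r) (place-injective r from from-injective)
      (place-surjective r from from-surjective)
      (λ s t → trans (from-adj _ _) (trans (adj-unionOfCopies (complete 3) r (place r s) (place r t))
        (cong₂ (blockAdj (adj (complete 3)) false) (split-place r s) (split-place r t))))
    inside : ∀ d x z → x ≢ z → ∃[ v ] (∀ w → ((d , v) , w) ⊵ ((d , x) , (d , z)))
    inside d x z x≢z with third x z x≢z
    ... | v , v≢x , v≢z , only = v , apex-⊵ (x≢z ∘ cong proj₂) (mate v≢x) (mate v≢z) others
      where
      mate : ∀ {y} → v ≢ y → blockAdj (adj (complete 3)) false (d , v) (d , y) ≡ true
      mate v≢y rewrite δ-refl d | δ-≢ v≢y = refl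
      others : ∀ w → w ≢ (d , x) → w ≢ (d , z) → blockAdj (adj (complete 3)) false (d , v) w ≡ false
      others (e , y) w≢x w≢z with d ≟ e
      ... | no  _    = refl
      ... | yes refl = cong not (trans (cong (δ v) (only y (w≢x ∘ cong (d ,_)) (w≢z ∘ cong (d ,_)))) (δ-refl v))

  balancedGreatest : ∀ r k → 2 ≤ r → 2 ≤ k → B ≅ joinOfCopies r (edgeless k) → Greatest q
  balancedGreatest r k 2≤r 2≤k iso = greatest-between (proj₂ (proj₂ (two 2≤r))) (proj₁ (two 2≤k))
    λ d x z x≢z → x , falseTwins-⊵ (x≢z ∘ cong proj₂) (λ _ → refl)
    where
    open FromIso (joinOfCopies r (edgeless k)) iso
    open Blocks (adj (edgeless k)) true (λ _ _ _ _ _ → refl) (from ∘ place r) (place-injective r from from-injective)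
      (place-surjective r from from-surjective)
      (λ s t → trans (from-adj _ _) (trans (adj-joinOfCopies (edgeless k) r (place r s) (place r t))
        (cong₂ (blockAdj (adj (edgeless k)) true) (split-place r s) (split-place r t))))

  -- A complete graph consists of blocks with a single vertex.
  completeGreatest : ∀ k → 2 ≤ k → B ≅ complete k → Greatest q
  completeGreatest k 2≤k iso = greatest-between (proj₂ (proj₂ (two 2≤k))) zero
    λ { _ zero zero x≢z → contradiction refl x≢z }
    where
    open FromIso (complete k) iso
    not-if : ∀ b → not b ≡ (if b then false else true)
    not-if true  = refl
    not-if false = refl
    singletons-injective : ∀ {s t : Fin k × Fin 1} → from (proj₁ s) ≡ from (proj₁ t) → s ≡ t
    singletons-injective {_ , zero} {_ , zero} eq = cong (_, zero) (from-injective eq)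
    open Blocks {k} {1} (λ _ _ → false) true (λ _ _ _ _ _ → refl) (from ∘ proj₁)
      singletons-injective
      (λ v → (to v , zero) , strictlyInverseʳ v)
      (λ (a , _) (c , _) → trans (from-adj a c) (not-if (δ a c)))

  -- A page is an apex of the two spine vertices, so a cross pair dominates them too.
  bookGreatest : ∀ m → 2 ≤ m → B ≅ complete 2 ⋈ edgeless m → Greatest q
  bookGreatest m 2≤m iso = greatest-cross zero page λ x z x≢z → zero , page ,
    ⊒-trans ⊒-swap (apex-⊵ (x≢z ∘ λ { refl → refl }) refl refl (others x z x≢z) (inj₁ zero))
    where
    page = proj₁ (two 2≤m)
    open FromIso (complete 2 ⋈ edgeless m) iso
    open Join (adj (complete 2)) complete-twins (adj (complete 2 ⋈ edgeless m))
      (λ _ _ → refl) (λ _ _ → refl) (λ _ _ → refl) (λ _ _ → refl) from from-injective from-surjective from-adj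
    others : ∀ x z → x ≢ z → ∀ w → w ≢ inj₁ x → w ≢ inj₁ z → adj (complete 2 ⋈ edgeless m) (inj₂ page) w ≡ false
    others _          _          _   (inj₂ _)          _   _   = refl
    others zero       zero       x≢z _                 _   _   = contradiction refl x≢z
    others (suc zero) (suc zero) x≢z _                 _   _   = contradiction refl x≢z
    others zero       (suc zero) _   (inj₁ zero)       w≢x _   = contradiction refl w≢x
    others zero       (suc zero) _   (inj₁ (suc zero)) _   w≢z = contradiction refl w≢z
    others (suc zero) zero       _   (inj₁ zero)       _   w≢z = contradiction refl w≢z
    others (suc zero) zero       _   (inj₁ (suc zero)) w≢x _   = contradiction refl w≢x

  bipartiteGreatest : ∀ k m → 1 ≤ k → k < m → B ≅ edgeless k ⋈ edgeless m → Greatest q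
  bipartiteGreatest k m 1≤k k<m iso = greatest-cross (one 1≤k) (one (ℕ.≤-<-trans z≤n k<m))
    λ x z x≢z → x , one (ℕ.≤-<-trans z≤n k<m) , falseTwins-⊵ (x≢z ∘ λ { refl → refl })
      (λ { (inj₁ _) → refl ; (inj₂ _) → refl }) _
    where
    open FromIso (edgeless k ⋈ edgeless m) iso
    open Join (adj (edgeless k)) (λ _ _ _ _ _ → refl) (adj (edgeless k ⋈ edgeless m))
      (λ _ _ → refl) (λ _ _ → refl) (λ _ _ → refl) (λ _ _ → refl) from from-injective from-surjective from-adj

  -- Rotations carry one edge to all five. A non-edge has the common neighbour of its ends as an
  -- apex, and is dominated by the edge from that apex to the next vertex.
  pentagonGreatest : B ≅ cycle 5 → Greatest q
  pentagonGreatest iso = greatest {zero} {suc zero} (λ ()) dominates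
    where
    open FromIso (cycle 5) iso
    C5 : Adjacency 5
    C5 = adj (cycle 5)
    open Labelled C5 from from-injective from-surjective from-adj
    rotate : Fin 5 → Fin 5
    rotate zero                         = suc zero
    rotate (suc zero)                   = suc (suc zero)
    rotate (suc (suc zero))             = suc (suc (suc zero))
    rotate (suc (suc (suc zero)))       = suc (suc (suc (suc zero)))
    rotate (suc (suc (suc (suc zero)))) = zero
    rotate-⊵ : ∀ {s t} → (s , t) ⊵ (rotate s , rotate t)
    rotate-⊵ = automorphism-⊵ rotate
      (from-yes (Fin.all? λ s → Fin.any? λ t → rotate t ≟ s))
      (from-yes (Fin.all? λ s → Fin.all? λ t → C5 (rotate s) (rotate t) Bool.≟ C5 s t))
    edge₁ : (zero , suc zero) ⊵ (suc zero , rotate (suc zero))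
    edge₁ = rotate-⊵
    edge₂ : (zero , suc zero) ⊵ (suc (suc zero) , rotate (suc (suc zero)))
    edge₂ = ⊒-trans edge₁ rotate-⊵
    edge₃ : (zero , suc zero) ⊵ (suc (suc (suc zero)) , rotate (suc (suc (suc zero))))
    edge₃ = ⊒-trans edge₂ rotate-⊵
    edge : ∀ s → (zero , suc zero) ⊵ (s , rotate s)
    edge zero                         = ⊒-refl
    edge (suc zero)                   = edge₁
    edge (suc (suc zero))             = edge₂
    edge (suc (suc (suc zero)))       = edge₃
    edge (suc (suc (suc (suc zero)))) = ⊒-trans edge₃ rotate-⊵
    pairs : ∀ s t → s ≢ t → t ≡ rotate s ⊎ s ≡ rotate t ⊎
      ∃[ v ] (C5 v s ≡ true × C5 v t ≡ true × (∀ w → w ≢ s → w ≢ t → C5 v w ≡ false))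
    pairs = from-yes (Fin.all? λ (s : Fin 5) → Fin.all? λ t → ¬? (s ≟ t) →-dec ((t ≟ rotate s) ⊎-dec ((s ≟ rotate t) ⊎-dec
      Fin.any? λ v → (C5 v s Bool.≟ true) ×-dec ((C5 v t Bool.≟ true) ×-dec
        Fin.all? λ w → ¬? (w ≟ s) →-dec (¬? (w ≟ t) →-dec (C5 v w Bool.≟ false))))))
    dominates : ∀ s t → s ≢ t → (zero , suc zero) ⊵ (s , t)
    dominates s t s≢t with pairs s t s≢t
    ... | inj₁ refl                          = edge s
    ... | inj₂ (inj₁ refl)                   = ⊒-trans (edge t) ⊒-swap
    ... | inj₂ (inj₂ (v , Cvs , Cvt , only)) = ⊒-trans (edge v) (apex-⊵ s≢t Cvs Cvt only (rotate v))

  sufficient : Family B → Greatest q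
  sufficient (inj₁ (r , 2≤r , iso))                                    = trianglesGreatest r 2≤r iso
  sufficient (inj₂ (inj₁ iso))                                         = pentagonGreatest iso
  sufficient (inj₂ (inj₂ (inj₁ (m , 2≤m , iso))))                      = bookGreatest m 2≤m iso
  sufficient (inj₂ (inj₂ (inj₂ (inj₁ (k , 2≤k , iso)))))               = completeGreatest k 2≤k iso
  sufficient (inj₂ (inj₂ (inj₂ (inj₂ (inj₁ (k , m , 1≤k , k<m , iso)))))) = bipartiteGreatest k m 1≤k k<m iso
  sufficient (inj₂ (inj₂ (inj₂ (inj₂ (inj₂ (r , k , 2≤r , 2≤k , iso)))))) = balancedGreatest r k 2≤r 2≤k iso

-- Removing the isolated vertices

≅-sym : ∀ {V W : Set} (G : Graph V) (H : Graph W) → G ≅ H → H ≅ G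
≅-sym G H (φ , φ-adj) = ↔-sym φ , λ u v →
  trans (sym (φ-adj (from u) (from v))) (cong₂ (adj H) (strictlyInverseˡ u) (strictlyInverseˡ v))
  where open Inverse φ

Family-resp : ∀ {V W : Set} (G : Graph V) (H : Graph W) → G ≅ H → Family H → Family G
Family-resp G H (φ , φ-adj) = λ where
    (inj₁ (r , 2≤r , iso))                                → inj₁ (r , 2≤r , compose (unionOfCopies r (complete 3)) iso)
    (inj₂ (inj₁ iso))                                     → inj₂ (inj₁ (compose (cycle 5) iso))
    (inj₂ (inj₂ (inj₁ (m , 2≤m , iso))))                  → inj₂ (inj₂ (inj₁ (m , 2≤m , compose (complete 2 ⋈ edgeless m) iso)))
    (inj₂ (inj₂ (inj₂ (inj₁ (k , 2≤k , iso)))))           → inj₂ (inj₂ (inj₂ (inj₁ (k , 2≤k , compose (complete k) iso))))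
    (inj₂ (inj₂ (inj₂ (inj₂ (inj₁ (k , m , 1≤k , k<m , iso)))))) →
      inj₂ (inj₂ (inj₂ (inj₂ (inj₁ (k , m , 1≤k , k<m , compose (edgeless k ⋈ edgeless m) iso)))))
    (inj₂ (inj₂ (inj₂ (inj₂ (inj₂ (r , k , 2≤r , 2≤k , iso)))))) →
      inj₂ (inj₂ (inj₂ (inj₂ (inj₂ (r , k , 2≤r , 2≤k , compose (joinOfCopies r (edgeless k)) iso)))))
  where
  compose : ∀ {X : Set} (K : Graph X) → H ≅ K → G ≅ K
  compose K (ψ , ψ-adj) = ψ ↔-∘ φ , λ u v → trans (ψ-adj _ _) (φ-adj u v)

module Reduction {V : Set} {n : ℕ} (numbering : Fin n ↔ V) (G : Graph V) where

  open Inverse numbering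

  numbered : Graph (Fin n)
  numbered .adj u v        = adj G (to u) (to v)
  numbered .adj-sym u v    = adj-sym G (to u) (to v)
  numbered .adj-irrefl v   = adj-irrefl G (to v)

  private
    A = adj numbered

    nonIsolated? : ∀ v → Dec (∃[ u ] A v u ≡ true)
    nonIsolated? v = Fin.any? (λ u → A v u Bool.≟ true)

  open Enumeration (enumerate (does ∘ nonIsolated?)) public

  N : ℕ
  N = count (does ∘ nonIsolated?)

  reduced : Graph (Fin N)
  reduced .adj s t        = A (elt s) (elt t)
  reduced .adj-sym s t    = adj-sym numbered (elt s) (elt t)
  reduced .adj-irrefl s   = adj-irrefl numbered (elt s)

  covers : ∀ v u → A v u ≡ true → ∃[ t ] elt t ≡ v
  covers v u Avu = complete-elt v (dec-true (nonIsolated? v) (u , Avu))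

  elt-nonIsolated : ∀ s → ∃[ u ] A (elt s) u ≡ true
  elt-nonIsolated s with nonIsolated? (elt s) | sound s
  ... | yes p | _ = p

  -- A neighbour of a retained vertex is itself not isolated, hence retained.
  neighbour : ∀ s → ∃[ t ] adj reduced s t ≡ true
  neighbour s with elt-nonIsolated s
  ... | u , Asu with covers u (elt s) (trans (adj-sym numbered u (elt s)) Asu)
  ...   | t , refl = t , Asu

  q : Point N → Bool
  q = polynomial (↔-id (Fin N)) reduced

  Q : Quadratic (adj reduced) q
  Q = polynomial-quadratic (↔-id (Fin N)) reduced

  polynomial-q : ∀ x → polynomial numbering G x ≡ q (x ∘ elt)
  polynomial-q = pullback numbered reduced (polynomial-quadratic numbering G) Q elt elt-injective (λ _ _ → refl) covers

  removeIsolated≅reduced : removeIsolated G ≅ reduced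
  removeIsolated≅reduced = isomorphism (removeIsolated G) reduced p
    (λ eq → elt-injective (to-injective (cong value eq))) surjective (λ _ _ → refl)
    where
    to-injective : ∀ {u v} → to u ≡ to v → u ≡ v
    to-injective {u} {v} eq = trans (sym (strictlyInverseʳ u)) (trans (cong from eq) (strictlyInverseʳ v))
    p : Fin N → [ v ∈ V ∣ NonIsolated G v ]
    p s = to (elt s) , [ to (proj₁ (elt-nonIsolated s)) , proj₂ (elt-nonIsolated s) ]
    index : ∀ v → NonIsolated G v → ∃[ t ] elt t ≡ from v
    index v (u , Gvu) = covers (from v) (from u)
      (trans (cong₂ (adj G) (strictlyInverseˡ v) (strictlyInverseˡ u)) Gvu)
    surjective : ∀ v → ∃[ s ] p s ≡ v
    surjective (v , [ nonIsolated ]) = proj₁ found ,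
      value-injective (trans (cong to (proj₂ found)) (strictlyInverseˡ v))
      where
      found : ∃[ t ] elt t ≡ from v
      -- The membership proof is irrelevant, but the search for an index is decidable, so an index
      -- can be recomputed from it.
      found = recompute (Fin.any? (λ t → elt t ≟ from v)) (index v nonIsolated)

module _ {V : Set} {n : ℕ} .{{_ : NonZero n}} (numbering : Fin n ↔ V) (G : Graph V)
  {N} (B : Graph (Fin N)) {q : Point N → Bool} (Q : Quadratic (adj B) q) (neighbour : ∀ s → ∃[ t ] adj B s t ≡ true)
  (e : Fin N → Fin n) (e-injective : ∀ {s t} → e s ≡ e t → s ≡ t)
  (polynomial-q : ∀ x → polynomial numbering G x ≡ q (x ∘ e)) (iso : removeIsolated G ≅ B) where

  private
    open Criterion numbering G Q neighbour e e-injective polynomial-q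

    necessary : Greatest q → Family (removeIsolated G)
    necessary (i , j , i≢j , dominates) = Family-resp (removeIsolated G) B iso (Necessity.family B Q neighbour i≢j dominates)

  classification : JoinIrreducible numbering G ⇔ Family (removeIsolated G)
  classification = mk⇔ (necessary ∘ irreducible⇒greatest)
    (greatest⇒irreducible ∘ Sufficiency.sufficient B Q ∘ Family-resp B (removeIsolated G) (≅-sym (removeIsolated G) B iso))

theorem22 : {V : Set} {n : ℕ} .{{_ : NonZero n}} (numbering : Fin n ↔ V) (G : Graph V) →
    JoinIrreducible numbering G ⇔
    ( (∃[ k ] (2 ≤ k × removeIsolated G ≅ unionOfCopies k (complete 3)))
    ⊎ (removeIsolated G ≅ cycle 5)
    ⊎ (∃[ m ] (2 ≤ m × removeIsolated G ≅ complete 2 ⋈ edgeless m))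
    ⊎ (∃[ k ] (2 ≤ k × removeIsolated G ≅ complete k))
    ⊎ (∃[ k ] ∃[ m ] (1 ≤ k × k < m × removeIsolated G ≅ edgeless k ⋈ edgeless m))
    ⊎ (∃[ r ] ∃[ k ] (2 ≤ r × 2 ≤ k × removeIsolated G ≅ joinOfCopies r (edgeless k))) )
theorem22 numbering G =
  classification numbering G reduced Q neighbour elt elt-injective polynomial-q removeIsolated≅reduced
  where open Reduction numbering G
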